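{- Let $G$ be a connected graph, $L$ a constant capacity function (uniform capacities) and $k$ a positive integer. (a) If LP1 for $(G,L,k)$ is feasible, then $G^6$ admits a hard-capacitated $k$-center solution. (b) If soft LP1 for $(G,L,k)$ is feasible, then $G^5$ admits a soft-capacitated $k$-center solution.
   Context: $G=(V,E)$ undirected unweighted, $\mathrm{dist}_G$ shortest-path distance, $L:V\to\mathbb{N}$, $k$ a positive integer. LP1: variables $x_{u,v},y_u$ with (1) $\sum_u y_u=k$; (2) $x_{u,v}\le y_u$; (3) $\sum_v x_{u,v}\le L(u)y_u$; (4) $\sum_u x_{u,v}=1$; (5) $0\le y_u\le1$; (6) $x_{u,v}=0$ if $\mathrm{dist}_G(u,v)>1$; (7) $x_{u,v}\ge0$. Soft LP1 is LP1 with the upper bound $y_u\le 1$ removed. $G^\delta$ is the graph on $V$ with $uv$ an edge iff $\mathrm{dist}_G(u,v)\le\delta$. A hard-capacitated $k$-center solution in a graph $H$ on $V$: a set $S\subseteq V$, $|S|\le k$, and $\phi:V\to S$ with $\phi(v)=v$ or $\phi(v)v\in E(H)$, and $|\phi^{ -1}(u)|\le L(u)$. A soft-capacitated $k$-center solution in $H$: $m:V\to\mathbb{Z}_{\ge0}$ with $\sum m(u)\le k$ and $\phi:V\to V$ with $m(\phi(v))\ge1$, $\phi(v)=v$ or $\phi(v)v\in E(H)$, and $|\phi^{ -1}(u)|\le L(u)m(u)$. -}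

module Defs where

open import Algebra.Bundles using (CommutativeRing)
import Algebra.Properties.Semiring.Mult as Mult
import Algebra.Properties.Semiring.Sum as Sum
open import Data.Fin.Base using (Fin)
open import Data.Fin.Properties using (_≟_; any?)
open import Data.Fin.Subset using (Subset; _∈_; ∣_∣)
open import Data.Nat.Base using (ℕ; zero; suc; _≤_; _<_; _*_; z≤n; s≤s)
import Data.Nat.Properties as ℕ
open import Data.Product.Base using (∃; ∃-syntax; ∃₂; _×_; _,_; proj₁; proj₂)
open import Data.Sum.Base using (_⊎_)
open import Data.Vec.Base using (tabulate)
open import Function.Base using (_∘_)
open import Level using (Level; 0ℓ; _⊔_) renaming (suc to lsuc)
open import Relation.Binary.Core using (Rel)
open import Relation.Binary.Definitions using (Decidable; Symmetric; Irreflexive)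
open import Relation.Binary.PropositionalEquality using (_≡_; refl; sym; subst)
open import Relation.Binary.Structures using (IsDecTotalOrder)
open import Relation.Nullary using (¬_; Dec; yes; no; does; contradiction)
open import Relation.Nullary.Decidable using (map′; _×-dec_; ¬?)
import Relation.Unary as U

-- The LP values live in an arbitrary ordered field.  The order is required to be
-- decidable; read classically this is no restriction, so ℝ is an instance, as is ℚ.
record OrderedField (c ℓ₁ ℓ₂ : Level) : Set (lsuc (c ⊔ ℓ₁ ⊔ ℓ₂)) where
  field
    commutativeRing : CommutativeRing c ℓ₁

  open CommutativeRing commutativeRing public
    using (Carrier; _≈_; _+_; 0#; 1#; semiring) renaming (_*_ to _*ᶠ_)

  infix 4 _≤ᶠ_
  field
    _≤ᶠ_            : Rel Carrier ℓ₂
    isDecTotalOrder : IsDecTotalOrder _≈_ _≤ᶠ_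
    +-monoˡ-≤ᶠ      : ∀ {x y} z → x ≤ᶠ y → x + z ≤ᶠ y + z
    *-nonneg        : ∀ {x y} → 0# ≤ᶠ x → 0# ≤ᶠ y → 0# ≤ᶠ x *ᶠ y
    0≉1             : ¬ 0# ≈ 1#
    inverse         : ∀ x → ¬ x ≈ 0# → ∃[ y ] x *ᶠ y ≈ 1#

  open Mult semiring public using () renaming (_×_ to _·_)
  open Sum semiring public using (sum; sum-syntax)

record Graph (n : ℕ) : Set₁ where
  field
    Adj        : Rel (Fin n) 0ℓ
    adj?       : Decidable Adj
    adj-sym    : Symmetric Adj
    adj-irrefl : Irreflexive _≡_ Adj

module _ {n : ℕ} (G : Graph n) where
  open Graph G

  data Walk : ℕ → Fin n → Fin n → Set where
    []  : ∀ {u} → Walk 0 u u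
    _∷_ : ∀ {d u v w} → Adj u v → Walk d v w → Walk (suc d) u w

  Connected : Set
  Connected = ∀ u v → ∃[ d ] Walk d u v

module _ {n : ℕ} {G : Graph n} where
  open Graph G

  walk? : ∀ d u v → Dec (Walk G d u v)
  walk? zero    u v = map′ (λ { refl → [] }) (λ { [] → refl }) (u ≟ v)
  walk? (suc d) u v =
    map′ (λ { (_ , e , p) → e ∷ p }) (λ { (e ∷ p) → _ , e , p })
         (any? λ w → adj? u w ×-dec walk? d w v)

  snoc : ∀ {d u v w} → Walk G d u v → Adj v w → Walk G (suc d) u w
  snoc []       e = e ∷ []
  snoc (e′ ∷ p) e = e′ ∷ snoc p e

  reverse : ∀ {d u v} → Walk G d u v → Walk G d v u
  reverse []      = []
  reverse (e ∷ p) = snoc (reverse p) (adj-sym e)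

Least : (ℕ → Set) → ℕ → Set
Least P m = P m × (∀ i → P i → m ≤ i)

least : {P : ℕ → Set} → U.Decidable P → ∀ m → P m → ∃ (Least P)
least P? zero    p = zero , p , λ _ _ → z≤n
least {P} P? (suc m) p with P? zero
... | yes p₀ = zero , p₀ , λ _ _ → z≤n
... | no ¬p₀ with least (P? ∘ suc) m p
...   | l , pl , min = suc l , pl , min′
  where
  min′ : ∀ i → P i → suc l ≤ i
  min′ zero    q = contradiction q ¬p₀
  min′ (suc i) q = s≤s (min i q)

module _ {n : ℕ} (G : Graph n) (conn : Connected G) where

  shortest : ∀ u v → ∃ (Least λ d → Walk G d u v)
  shortest u v = least (λ d → walk? d u v) (proj₁ (conn u v)) (proj₂ (conn u v))

  dist : Fin n → Fin n → ℕ
  dist u v = proj₁ (shortest u v)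

  dist-sym : ∀ u v → dist u v ≡ dist v u
  dist-sym u v = ℕ.≤-antisym (half u v) (half v u)
    where
    half : ∀ a b → dist a b ≤ dist b a
    half a b = proj₂ (proj₂ (shortest a b)) _ (reverse (proj₁ (proj₂ (shortest b a))))

  power : ℕ → Graph n
  power δ = record
    { Adj        = λ u v → ¬ u ≡ v × dist u v ≤ δ
    ; adj?       = λ u v → ¬? (u ≟ v) ×-dec (dist u v ℕ.≤? δ)
    ; adj-sym    = λ {u} {v} (u≢v , d≤δ) → (u≢v ∘ sym) , subst (_≤ δ) (dist-sym u v) d≤δ
    ; adj-irrefl = λ u≡v (u≢v , _) → u≢v u≡v
    }

module _ {c ℓ₁ ℓ₂} (F : OrderedField c ℓ₁ ℓ₂)
         {n : ℕ} (G : Graph n) (conn : Connected G) (L : Fin n → ℕ) (k : ℕ) where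
  open OrderedField F

  -- In x u v, u is the centre and v the client.  The numerical constants k and L u
  -- enter F as natural multiples (_·_).
  record IsSoftLP1Solution (x : Fin n → Fin n → Carrier) (y : Fin n → Carrier)
         : Set (ℓ₁ ⊔ ℓ₂) where
    field
      total    : ∑[ u < n ] y u ≈ k · 1#
      x≤y      : ∀ u v → x u v ≤ᶠ y u
      capacity : ∀ u → ∑[ v < n ] x u v ≤ᶠ L u · y u
      covered  : ∀ v → ∑[ u < n ] x u v ≈ 1#
      0≤y      : ∀ u → 0# ≤ᶠ y u
      local    : ∀ u v → 1 < dist G conn u v → x u v ≈ 0#
      0≤x      : ∀ u v → 0# ≤ᶠ x u v

  record IsLP1Solution (x : Fin n → Fin n → Carrier) (y : Fin n → Carrier)
         : Set (ℓ₁ ⊔ ℓ₂) where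
    field
      isSoftLP1Solution : IsSoftLP1Solution x y
      y≤1               : ∀ u → y u ≤ᶠ 1#
    open IsSoftLP1Solution isSoftLP1Solution public

  SoftLP1Feasible : Set (c ⊔ ℓ₁ ⊔ ℓ₂)
  SoftLP1Feasible = ∃₂ IsSoftLP1Solution

  LP1Feasible : Set (c ⊔ ℓ₁ ⊔ ℓ₂)
  LP1Feasible = ∃₂ IsLP1Solution

fibre : ∀ {n} → (Fin n → Fin n) → Fin n → Subset n
fibre φ u = tabulate λ v → does (φ v ≟ u)

open Sum ℕ.+-*-semiring using () renaming (sum to sumℕ)

module _ {n : ℕ} (H : Graph n) (L : Fin n → ℕ) (k : ℕ) where
  open Graph H

  record HardSolution : Set where
    field
      S        : Subset n
      ∣S∣≤k    : ∣ S ∣ ≤ k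
      φ        : Fin n → Fin n
      φ∈S      : ∀ v → φ v ∈ S
      near     : ∀ v → φ v ≡ v ⊎ Adj (φ v) v
      capacity : ∀ u → u ∈ S → ∣ fibre φ u ∣ ≤ L u

  record SoftSolution : Set where
    field
      m        : Fin n → ℕ
      Σm≤k     : sumℕ m ≤ k
      φ        : Fin n → Fin n
      open-φ   : ∀ v → 1 ≤ m (φ v)
      near     : ∀ v → φ v ≡ v ⊎ Adj (φ v) v
      capacity : ∀ u → ∣ fibre φ u ∣ ≤ L u * m u

{-# OPTIONS --safe #-}
-- The upper bound y ≤ 1 is irrelevant: both solutions come out of one rounding of
-- soft LP1.  Choose "monarchs" at pairwise distance ≥ 3 that cover V within distance 2,
-- arranged in a tree whose edges are paths c – b – a – p of length 3.  Summing the LP over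
-- centres gives |U| + ℓ |M′| ≤ ℓ k for every client set U and every set M′ of monarchs
-- farther than 2 from U, which is Hall's condition for lodging each client with a
-- monarch within distance 2 (at most ℓ each) or leaving it free (at most
-- ℓ (k - |M|) in all).
--
-- Now retire monarchs leaves first.  A retiring monarch c opens one centre, plus one more
-- for every ℓ free clients at hand, and hands the fewer than ℓ clients left over to
-- its parent; these can be taken from the clients lodged with c, so they are within 2 of
-- c and 5 of the parent.  That settles (b), all centres being at monarchs.  For (a)
-- the handed-over clients wait at the intermediate vertex a, with the unused vertex b in
-- reserve: once ℓ clients wait at a, a centre opens at a reserved neighbour of a, within
-- distance 5 of them.  So fewer than ℓ wait at each neighbour a of p, and when p retires
-- they fit into centres at p and its neighbours, within distance 6.  Enough distinct
-- vertices are available as soon as ℓ ≥ 2 and n ≥ 2; in the other cases n ≤ k.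
module Submission where

open import Defs
open import Algebra.Bundles using (CommutativeRing)
import Algebra.Properties.Ring as RingProperties
import Algebra.Properties.Semiring.Mult as Mult
import Algebra.Properties.Semiring.Sum as Sum
open import Data.Bool.Base using (Bool; true; false; if_then_else_; _∧_; _∨_; not)
import Data.Bool.Properties as Bool
open import Data.Fin.Base using (Fin; zero; suc)
import Data.Fin.Properties as Fin
open import Data.Fin.Subset as Subset using (Subset; ∣_∣; _∪_; _∩_; ⊥; inside; outside)
open import Data.Fin.Subset.Properties using (∣⊤∣≡n; ∈⊤; anySubset?)
open import Data.List.Base
  using (List; []; _∷_; _++_; length; map; filter; take; drop; concatMap; tabulate; allFin)
open import Data.List.Membership.Propositional using (_∈_; _∉_; find; lose)
open import Data.List.Membership.Propositional.Properties
import Data.List.Properties as List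
open import Data.List.Relation.Unary.All as All using (All; []; _∷_)
import Data.List.Relation.Unary.All.Properties as All
open import Data.List.Relation.Unary.Any as Any using (Any; here; there)
import Data.List.Relation.Unary.Any.Properties as Any
open import Data.List.Relation.Unary.Unique.Propositional using (Unique; []; _∷_)
import Data.List.Relation.Unary.Unique.Propositional.Properties as Unique
open import Data.Nat.Base as ℕ
  using (ℕ; zero; suc; _+_; _∸_; _*_; _/_; _%_; _≤_; _<_; z≤n; s≤s; NonZero)
import Data.Nat.DivMod as ℕ
import Data.Nat.Properties as ℕ
open import Data.Nat.Tactic.RingSolver using (solve-∀)
open import Data.Product.Base using (∃; ∃₂; _×_; _,_; proj₁; proj₂)
open import Data.Sum.Base using (_⊎_; inj₁; inj₂; [_,_]′)
open import Data.Vec.Base as Vec using ([]; _∷_)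
open import Data.Vec.Functional using (updateAt)
open import Data.Vec.Functional.Properties using (updateAt-updates; updateAt-minimal)
open import Data.Vec.Properties using ([]=⇒lookup; lookup⇒[]=; lookup∘tabulate)
open import Function.Base using (_∘_; id; case_of_; const)
open import Level using (Level)
open import Relation.Binary.PropositionalEquality
  using (_≡_; _≢_; refl; sym; trans; cong; cong₂; subst; module ≡-Reasoning)
open import Relation.Binary.Structures using (IsDecTotalOrder)
open import Relation.Nullary using (¬_; Dec; yes; no; does; contradiction)
open import Relation.Nullary.Decidable using (_×-dec_; ¬?; dec-true; decidable-stable)
open import Relation.Unary using (Pred; Decidable)
open Sum ℕ.+-*-semiring using (sum-cong-≗; ∑-distrib-+; *-distribʳ-sum) renaming (sum to sumℕ)


-- Distances and the linear program

count : ∀ {n} → (Fin n → Bool) → ℕ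
count χ = sumℕ λ v → if χ v then 1 else 0

module _ {n} {G : Graph n} where
  open Graph G

  _◅◅_ : ∀ {d e u v w} → Walk G d u v → Walk G e v w → Walk G (d + e) u w
  []      ◅◅ q = q
  (e ∷ p) ◅◅ q = e ∷ (p ◅◅ q)

module Distance {n} (G : Graph n) (conn : Connected G) where
  open Graph G

  walk⇒dist≤ : ∀ {d u v} → Walk G d u v → dist G conn u v ≤ d
  walk⇒dist≤ {d} {u} {v} = proj₂ (proj₂ (shortest G conn u v)) d

  geodesic : ∀ u v → Walk G (dist G conn u v) u v
  geodesic u v = proj₁ (proj₂ (shortest G conn u v))

  Within : ℕ → Fin n → Fin n → Set
  Within d u v = dist G conn u v ≤ d

  within-refl : ∀ {d u} → Within d u u
  within-refl = ℕ.≤-trans (walk⇒dist≤ []) z≤n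

  within-sym : ∀ {d u v} → Within d u v → Within d v u
  within-sym {d} {u} {v} = subst (_≤ d) (dist-sym G conn u v)

  within-trans : ∀ {d e u v w} → Within d u v → Within e v w → Within (d + e) u w
  within-trans {u = u} {v} {w} p q =
    ℕ.≤-trans (walk⇒dist≤ (geodesic u v ◅◅ geodesic v w)) (ℕ.+-mono-≤ p q)

  adj⇒within : ∀ {u v} → Adj u v → Within 1 u v
  adj⇒within e = walk⇒dist≤ (e ∷ [])

-- Arithmetic in an ordered field

module OrderedFieldProperties {c ℓ₁ ℓ₂} (F : OrderedField c ℓ₁ ℓ₂) where
  open OrderedField F renaming (_+_ to _+ᶠ_)
  private
    module R = CommutativeRing commutativeRing
    module O = IsDecTotalOrder isDecTotalOrder
  open RingProperties R.ring using (-‿involutive; -‿distribˡ-*)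
  open Sum semiring public using (sum-cong-≋; ∑-comm) renaming (∑-distrib-+ to sum-distrib-+)
  open Mult semiring public using (×-congʳ; ×-homo-+; ×-assocˡ)

  ≤ᶠ-reflexive : ∀ {x y} → x ≈ y → x ≤ᶠ y
  ≤ᶠ-reflexive = O.reflexive

  ≤ᶠ-trans : ∀ {x y z} → x ≤ᶠ y → y ≤ᶠ z → x ≤ᶠ z
  ≤ᶠ-trans = O.trans

  +-mono-≤ᶠ : ∀ {x y z w} → x ≤ᶠ y → z ≤ᶠ w → x +ᶠ z ≤ᶠ y +ᶠ w
  +-mono-≤ᶠ {x} {y} {z} {w} p q =
    O.trans (+-monoˡ-≤ᶠ z p)
      (O.trans (O.reflexive (R.+-comm y z))
        (O.trans (+-monoˡ-≤ᶠ y q) (O.reflexive (R.+-comm w y))))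

  -- By totality: if 1 ≤ 0 then -1 is nonnegative, and 1 is its square.
  0≤1 : 0# ≤ᶠ 1#
  0≤1 with O.total 0# 1#
  ... | inj₁ p = p
  ... | inj₂ p = O.trans (*-nonneg 0≤-1 0≤-1) (O.reflexive square)
    where
    0≤-1 : 0# ≤ᶠ R.- 1#
    0≤-1 = O.trans (O.reflexive (R.sym (R.-‿inverseʳ 1#)))
             (O.trans (+-monoˡ-≤ᶠ (R.- 1#) p) (O.reflexive (R.+-identityˡ _)))
    square : (R.- 1#) *ᶠ (R.- 1#) ≈ 1#
    square = R.trans (R.sym (-‿distribˡ-* 1# (R.- 1#)))
               (R.trans (R.-‿cong (R.*-identityˡ _)) (-‿involutive 1#))

  ·-monoʳ-≤ᶠ : ∀ p {x y} → x ≤ᶠ y → p · x ≤ᶠ p · y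
  ·-monoʳ-≤ᶠ zero    x≤y = O.refl
  ·-monoʳ-≤ᶠ (suc p) x≤y = +-mono-≤ᶠ x≤y (·-monoʳ-≤ᶠ p x≤y)

  0≤·1 : ∀ p → 0# ≤ᶠ p · 1#
  0≤·1 zero    = O.refl
  0≤·1 (suc p) = O.trans (O.reflexive (R.sym (R.+-identityˡ 0#))) (+-mono-≤ᶠ 0≤1 (0≤·1 p))

  -- Carries inequalities between LP values back to ℕ. A positive multiple of 1 lying below 0 would
  -- force 0 ≈ 1 by antisymmetry.
  ·1-cancel-≤ : ∀ p q → p · 1# ≤ᶠ q · 1# → p ≤ q
  ·1-cancel-≤ zero    q       _ = z≤n
  ·1-cancel-≤ (suc p) zero    h =
    contradiction (O.antisym 0≤1 (O.trans 1≤ h)) 0≉1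
    where
    1≤ : 1# ≤ᶠ suc p · 1#
    1≤ = O.trans (O.reflexive (R.sym (R.+-identityʳ 1#))) (+-mono-≤ᶠ O.refl (0≤·1 p))
  ·1-cancel-≤ (suc p) (suc q) h =
    s≤s (·1-cancel-≤ p q
      (O.trans (O.reflexive (R.sym (drop1 _))) (O.trans (+-mono-≤ᶠ O.refl h) (O.reflexive (drop1 _)))))
    where
    drop1 : ∀ z → R.- 1# +ᶠ (1# +ᶠ z) ≈ z
    drop1 z = R.trans (R.sym (R.+-assoc _ _ _))
                (R.trans (R.+-congʳ (R.-‿inverseˡ 1#)) (R.+-identityˡ z))

  sum-mono-≤ᶠ : ∀ {m} {f g : Fin m → Carrier} → (∀ i → f i ≤ᶠ g i) → sum f ≤ᶠ sum g
  sum-mono-≤ᶠ {zero}  h = O.refl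
  sum-mono-≤ᶠ {suc m} h = +-mono-≤ᶠ (h zero) (sum-mono-≤ᶠ (h ∘ suc))

  sum-zero : ∀ {m} {f : Fin m → Carrier} → (∀ i → f i ≈ 0#) → sum f ≈ 0#
  sum-zero {zero}  h = R.refl
  sum-zero {suc m} h = R.trans (R.+-cong (h zero) (sum-zero (h ∘ suc))) (R.+-identityˡ 0#)

  sum-≤-single : ∀ {m} {f : Fin m → Carrier} i →
                 (∀ j → j ≢ i → f j ≈ 0#) → sum f ≤ᶠ f i
  sum-≤-single {suc m} zero h =
    O.reflexive (R.trans (R.+-congˡ (sum-zero λ j → h (suc j) λ ())) (R.+-identityʳ _))
  sum-≤-single {suc m} (suc i) h =
    O.trans (+-mono-≤ᶠ (O.reflexive (h zero λ ()))
                       (sum-≤-single i λ j j≢i → h (suc j) (j≢i ∘ Fin.suc-injective)))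
            (O.reflexive (R.+-identityˡ _))

  ·-distrib-sum : ∀ p {m} (f : Fin m → Carrier) → sum (λ i → p · f i) ≈ p · sum f
  ·-distrib-sum zero    {m} f = sum-zero {m} λ _ → R.refl
  ·-distrib-sum (suc p) {m} f =
    R.trans (sum-distrib-+ f (λ i → p · f i)) (R.+-congˡ (·-distrib-sum p f))

  when : Bool → Carrier → Carrier
  when b z = if b then z else 0#

  sum-when : ∀ {m} b (f : Fin m → Carrier) → sum (λ i → when b (f i)) ≈ when b (sum f)
  sum-when true  f = R.refl
  sum-when {m} false f = sum-zero {m} λ _ → R.refl

  when-≤ : ∀ b {z w} → 0# ≤ᶠ w → z ≤ᶠ w → when b z ≤ᶠ w
  when-≤ true  _   z≤w = z≤w
  when-≤ false 0≤w _   = 0≤w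

  count-· : ∀ {m} (χ : Fin m → Bool) → sum (λ i → when (χ i) 1#) ≈ count χ · 1#
  count-· {zero}  χ = R.refl
  count-· {suc m} χ with χ zero
  ... | true  = R.+-congˡ (count-· (χ ∘ suc))
  ... | false = R.trans (R.+-identityˡ _) (count-· (χ ∘ suc))

  when-cong : ∀ b {z w} → z ≈ w → when b z ≈ when b w
  when-cong true  h = h
  when-cong false h = R.refl

  when-≈0 : ∀ b {z} → (b ≡ true → z ≈ 0#) → when b z ≈ 0#
  when-≈0 true  h = h refl
  when-≈0 false h = R.refl

  ·-zeroʳ : ∀ p {z} → z ≈ 0# → p · z ≈ 0#
  ·-zeroʳ zero    h = R.refl
  ·-zeroʳ (suc p) h = R.trans (R.+-cong h (·-zeroʳ p h)) (R.+-identityˡ 0#)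

-- The counting inequality from the linear program

module LPBound {c ℓ₁ ℓ₂} (F : OrderedField c ℓ₁ ℓ₂) {n} (G : Graph n) (conn : Connected G)
               (L : Fin n → ℕ) (k ℓ : ℕ) (L≡ℓ : ∀ u → L u ≡ ℓ)
               (feasible : SoftLP1Feasible F G conn L k) where
  open OrderedField F renaming (_+_ to _+ᶠ_)
  open OrderedFieldProperties F
  open Distance G conn
  open IsSoftLP1Solution (proj₂ (proj₂ feasible))
  private
    module R = CommutativeRing commutativeRing
    x = proj₁ feasible
    y = proj₁ (proj₂ feasible)

  -- No centre u can contribute both to a client in χ and to a vertex in ψ, and it
  -- contributes to at most one vertex in ψ; now sum over u.
  clients+closed≤ : (χ ψ : Fin n → Bool) →
    (∀ {m m′} → ψ m ≡ true → ψ m′ ≡ true → m ≢ m′ → ¬ Within 2 m m′) →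
    (∀ {v m} → χ v ≡ true → ψ m ≡ true → ¬ Within 2 m v) →
    count χ + ℓ * count ψ ≤ ℓ * k
  clients+closed≤ χ ψ packed apart = ·1-cancel-≤ _ _
    (≤ᶠ-trans (≤ᶠ-reflexive (R.sym total≈))
      (≤ᶠ-trans (sum-mono-≤ᶠ per-centre)
        (≤ᶠ-reflexive (R.trans (·-distrib-sum ℓ y)
          (R.trans (×-congʳ ℓ total) (×-assocˡ 1# ℓ k))))))
    where
    served : (Fin n → Bool) → Fin n → Carrier
    served θ u = sum λ v → when (θ v) (x u v)

    total-served : ∀ θ → sum (served θ) ≈ count θ · 1#
    total-served θ =
      R.trans (∑-comm λ u v → when (θ v) (x u v))
        (R.trans (sum-cong-≋ λ v → R.trans (sum-when (θ v) λ u → x u v) (when-cong (θ v) (covered v)))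
          (count-· θ))

    total≈ : sum (λ u → served χ u +ᶠ ℓ · served ψ u) ≈ (count χ + ℓ * count ψ) · 1#
    total≈ = R.trans (sum-distrib-+ (served χ) (λ u → ℓ · served ψ u))
      (R.trans (R.+-cong (total-served χ)
                 (R.trans (·-distrib-sum ℓ (served ψ))
                   (R.trans (×-congʳ ℓ (total-served ψ)) (×-assocˡ 1# ℓ (count ψ)))))
               (R.sym (×-homo-+ 1# (count χ) (ℓ * count ψ))))

    far : ∀ {u v} → ¬ Within 1 u v → x u v ≈ 0#
    far {u} {v} ¬w = local u v (ℕ.≰⇒> ¬w)

    near-ψ? : ∀ u → Dec (∃ λ m → ψ m ≡ true × Within 1 u m)
    near-ψ? u = Fin.any? λ m → (ψ m Bool.≟ true) ×-dec (dist G conn u m ℕ.≤? 1)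

    per-centre : ∀ u → served χ u +ᶠ ℓ · served ψ u ≤ᶠ ℓ · y u
    per-centre u with near-ψ? u
    -- Everything `u` serves is within 2 of `m`: `apart` rules out all of χ and `packed` all of ψ
    -- but `m`, which leaves `x u m`, at most `y u`.
    ... | yes (m , ψm , um) =
      ≤ᶠ-trans (+-mono-≤ᶠ (≤ᶠ-reflexive χ-zero) (·-monoʳ-≤ᶠ ℓ ψ-one))
               (≤ᶠ-reflexive (R.+-identityˡ _))
      where
      χ-zero : served χ u ≈ 0#
      χ-zero = sum-zero λ v → when-≈0 (χ v) λ χv →
        far λ uv → apart χv ψm (within-trans (within-sym um) uv)
      ψ-one : served ψ u ≤ᶠ y u
      ψ-one = ≤ᶠ-trans
        (sum-≤-single m λ j j≢m → when-≈0 (ψ j) λ ψj →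
          far λ uj → packed ψj ψm j≢m (within-trans (within-sym uj) um))
        (when-≤ (ψ m) (0≤y u) (x≤y u m))
    -- Here `u` serves nothing in ψ, and the capacity constraint bounds what it gives to χ.
    ... | no ¬near =
      ≤ᶠ-trans (+-mono-≤ᶠ χ≤ (≤ᶠ-reflexive (·-zeroʳ ℓ ψ-zero)))
               (≤ᶠ-reflexive (R.+-identityʳ _))
      where
      χ≤ : served χ u ≤ᶠ ℓ · y u
      χ≤ = subst (λ l → served χ u ≤ᶠ l · y u) (L≡ℓ u)
        (≤ᶠ-trans (sum-mono-≤ᶠ λ v → when-≤ (χ v) (0≤x u v) (≤ᶠ-reflexive R.refl)) (capacity u))
      ψ-zero : served ψ u ≈ 0#
      ψ-zero = sum-zero λ m → when-≈0 (ψ m) λ ψm → far λ um → ¬near (m , ψm , um)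

-- Hall's theorem with capacities

sum-mono-≤ : ∀ {n} {f g : Fin n → ℕ} → (∀ i → f i ≤ g i) → sumℕ f ≤ sumℕ g
sum-mono-≤ {zero}  h = z≤n
sum-mono-≤ {suc n} h = ℕ.+-mono-≤ (h zero) (sum-mono-≤ (h ∘ suc))

[_] : Bool → ℕ
[ b ] = if b then 1 else 0

sum-zeroℕ : ∀ {n} {f : Fin n → ℕ} → (∀ i → f i ≡ 0) → sumℕ f ≡ 0
sum-zeroℕ {zero}  h = refl
sum-zeroℕ {suc n} h = cong₂ _+_ (h zero) (sum-zeroℕ (h ∘ suc))

count-≟ : ∀ {n} (j : Fin n) → count (λ i → does (j Fin.≟ i)) ≡ 1
count-≟ {suc n} zero    = cong suc (sum-zeroℕ {n} λ _ → refl)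
count-≟ {suc n} (suc j) = count-≟ j

∣∪∣+∣∩∣ : ∀ {n} (A B : Subset n) → ∣ A ∪ B ∣ + ∣ A ∩ B ∣ ≡ ∣ A ∣ + ∣ B ∣
∣∪∣+∣∩∣ []            []            = refl
∣∪∣+∣∩∣ (outside ∷ A) (outside ∷ B) = ∣∪∣+∣∩∣ A B
∣∪∣+∣∩∣ (outside ∷ A) (inside  ∷ B) = trans (cong suc (∣∪∣+∣∩∣ A B)) (sym (ℕ.+-suc ∣ A ∣ ∣ B ∣))
∣∪∣+∣∩∣ (inside  ∷ A) (outside ∷ B) = cong suc (∣∪∣+∣∩∣ A B)
∣∪∣+∣∩∣ (inside  ∷ A) (inside  ∷ B) = cong suc
  (trans (ℕ.+-suc _ _) (trans (cong suc (∣∪∣+∣∩∣ A B)) (sym (ℕ.+-suc ∣ A ∣ ∣ B ∣))))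

module _ {p : ℕ} where

  -- The indicator of the neighbourhood of `A`. Recursion on `A` makes Hall's condition for
  -- `outside ∷ A` definitionally the condition for `A` with the first client removed.
  hit : ∀ {n} → (Fin n → Fin p → Bool) → Subset n → Fin p → Bool
  hit N []      j = false
  hit N (b ∷ A) j = (b ∧ N zero j) ∨ hit (N ∘ suc) A j

  weight : ∀ {n} → (Fin n → Fin p → Bool) → (Fin p → ℕ) → Subset n → ℕ
  weight N c A = sumℕ λ j → if hit N A j then c j else 0

  Hall : ∀ {n} → (Fin n → Fin p → Bool) → (Fin p → ℕ) → Set
  Hall N c = ∀ A → ∣ A ∣ ≤ weight N c A

  hit-⊥ : ∀ {n} (N : Fin n → Fin p → Bool) j → hit N ⊥ j ≡ false
  hit-⊥ {zero}  N j = refl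
  hit-⊥ {suc n} N j = hit-⊥ (N ∘ suc) j

  hit-∪ : ∀ {n} (N : Fin n → Fin p → Bool) A B j → hit N (A ∪ B) j ≡ hit N A j ∨ hit N B j
  hit-∪ N []      []      j = refl
  hit-∪ N (a ∷ A) (b ∷ B) j rewrite hit-∪ (N ∘ suc) A B j with a | b | N zero j | hit (N ∘ suc) A j
  ... | false | false | _     | _     = refl
  ... | false | true  | false | _     = refl
  ... | false | true  | true  | false = refl
  ... | false | true  | true  | true  = refl
  ... | true  | false | false | _     = refl
  ... | true  | false | true  | _     = refl
  ... | true  | true  | false | _     = refl
  ... | true  | true  | true  | _     = refl

  hit-∩ : ∀ {n} (N : Fin n → Fin p → Bool) A B j →
          hit N (A ∩ B) j ≡ true → hit N A j ≡ true × hit N B j ≡ true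
  hit-∩ N []      []      j ()
  hit-∩ N (a ∷ A) (b ∷ B) j h with a | b | N zero j | hit-∩ (N ∘ suc) A B j
  ... | true  | true  | true  | _  = refl , refl
  ... | true  | true  | false | ih = ih h
  ... | true  | false | true  | ih = refl , proj₂ (ih h)
  ... | true  | false | false | ih = ih h
  ... | false | true  | true  | ih = proj₁ (ih h) , refl
  ... | false | true  | false | ih = ih h
  ... | false | false | _     | ih = ih h

  module _ {n} (N : Fin n → Fin p → Bool) (c : Fin p → ℕ) where

    -- Under Hall's condition this inequality is an equality.
    Tight : Subset n → Set
    Tight A = weight N c A ≤ ∣ A ∣

    weight-⊥ : weight N c ⊥ ≡ 0
    weight-⊥ = sum-zeroℕ λ j → cong (λ b → if b then c j else 0) (hit-⊥ N j)

    -- Neighbourhoods commute with unions, but the neighbourhood of an intersection may be smaller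
    -- than the intersection of the neighbourhoods; hence an inequality.
    weight-submodular : ∀ A B → weight N c (A ∪ B) + weight N c (A ∩ B) ≤ weight N c A + weight N c B
    weight-submodular A B = begin
      weight N c (A ∪ B) + weight N c (A ∩ B)   ≡⟨ ∑-distrib-+ (term (A ∪ B)) (term (A ∩ B)) ⟨
      sumℕ (λ j → term (A ∪ B) j + term (A ∩ B) j) ≤⟨ sum-mono-≤ pointwise ⟩
      sumℕ (λ j → term A j + term B j)          ≡⟨ ∑-distrib-+ (term A) (term B) ⟩
      weight N c A + weight N c B               ∎
      where
      open ℕ.≤-Reasoning
      term : Subset n → Fin p → ℕ
      term A j = if hit N A j then c j else 0
      pointwise : ∀ j → term (A ∪ B) j + term (A ∩ B) j ≤ term A j + term B j
      pointwise j rewrite hit-∪ N A B j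
        with hit N A j | hit N B j | hit N (A ∩ B) j | hit-∩ N A B j
      ... | true  | true  | true  | _ = ℕ.≤-refl
      ... | true  | true  | false | _ = ℕ.+-monoʳ-≤ (c j) z≤n
      ... | true  | false | true  | h = case proj₂ (h refl) of λ ()
      ... | true  | false | false | _ = ℕ.≤-refl
      ... | false | _     | true  | h = case proj₁ (h refl) of λ ()
      ... | false | true  | false | _ = ℕ.≤-reflexive (ℕ.+-identityʳ (c j))
      ... | false | false | false | _ = z≤n

    module _ (hall-N : Hall N c) where

      -- Uncrossing: weight is submodular, cardinality is modular, and Hall's condition at the
      -- intersection leaves no slack for the union.
      tight-∪ : ∀ {A B} → Tight A → Tight B → Tight (A ∪ B)
      tight-∪ {A} {B} tA tB = ℕ.+-cancelʳ-≤ _ _ _ (begin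
        weight N c (A ∪ B) + weight N c (A ∩ B) ≤⟨ weight-submodular A B ⟩
        weight N c A + weight N c B             ≤⟨ ℕ.+-mono-≤ tA tB ⟩
        ∣ A ∣ + ∣ B ∣                           ≡⟨ ∣∪∣+∣∩∣ A B ⟨
        ∣ A ∪ B ∣ + ∣ A ∩ B ∣                   ≤⟨ ℕ.+-monoʳ-≤ ∣ A ∪ B ∣ (hall-N (A ∩ B)) ⟩
        ∣ A ∪ B ∣ + weight N c (A ∩ B)          ∎)
        where open ℕ.≤-Reasoning

      tight-⋃ : ∀ {q} (A : Fin q → Subset n) → (∀ i → Tight (A i)) →
                ∃ λ B → Tight B × (∀ i j → hit N (A i) j ≡ true → hit N B j ≡ true)
      tight-⋃ {zero}  A t = ⊥ , ℕ.≤-trans (ℕ.≤-reflexive weight-⊥) z≤n , λ ()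
      tight-⋃ {suc q} A t with tight-⋃ (A ∘ suc) (t ∘ suc)
      ... | B , tB , sub = A zero ∪ B , tight-∪ {A zero} {B} (t zero) tB , sub′
        where
        sub′ : ∀ i j → hit N (A i) j ≡ true → hit N (A zero ∪ B) j ≡ true
        sub′ zero    j h rewrite hit-∪ N (A zero) B j | h = refl
        sub′ (suc i) j h rewrite hit-∪ N (A zero) B j | sub i j h = Bool.∨-zeroʳ _

      use : Fin p → Fin p → ℕ
      use j i = c i ∸ [ does (j Fin.≟ i) ]

      -- A set that violates Hall's condition once j has lost a unit was tight before.
      violation⇒tight : ∀ j A → weight N (use j) A < ∣ A ∣ → Tight A × hit N A j ≡ true
      violation⇒tight j A w< with hit N A j in eq
      ... | true  = tight , refl
        where
        open ℕ.≤-Reasoning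
        pointwise : ∀ i → (if hit N A i then c i else 0) ≤
                          [ does (j Fin.≟ i) ] + (if hit N A i then use j i else 0)
        pointwise i with hit N A i
        ... | true  = ℕ.m≤n+m∸n (c i) [ does (j Fin.≟ i) ]
        ... | false = z≤n
        tight : Tight A
        tight = begin
          weight N c A ≤⟨ sum-mono-≤ pointwise ⟩
          sumℕ (λ i → [ does (j Fin.≟ i) ] + (if hit N A i then use j i else 0))
            ≡⟨ ∑-distrib-+ (λ i → [ does (j Fin.≟ i) ]) (λ i → if hit N A i then use j i else 0) ⟩
          count (λ i → does (j Fin.≟ i)) + weight N (use j) A
            ≡⟨ cong (_+ weight N (use j) A) (count-≟ j) ⟩
          suc (weight N (use j) A) ≤⟨ w< ⟩
          ∣ A ∣ ∎
      ... | false = contradiction (ℕ.<-≤-trans w< (hall-N A)) (ℕ.<-irrefl (sum-cong-≗ same))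
        where
        same : ∀ i → (if hit N A i then use j i else 0) ≡ (if hit N A i then c i else 0)
        same i with hit N A i in eqᵢ
        ... | false = refl
        ... | true with j Fin.≟ i
        ...   | no _     = refl
        ...   | yes refl = case trans (sym eq) eqᵢ of λ ()

      -- One unit of `j` can go to the first client without breaking Hall's condition for the
      -- others.
      Expendable : (Fin p → Bool) → Fin p → Set
      Expendable N₀ j = (N₀ j ≡ true × 1 ≤ c j) × ¬ ∃ λ A → weight N (use j) A < ∣ A ∣

      expendable? : ∀ N₀ j → Dec (Expendable N₀ j)
      expendable? N₀ j = ((N₀ j Bool.≟ true) ×-dec (1 ℕ.≤? c j)) ×-dec
        ¬? (anySubset? λ A → weight N (use j) A ℕ.<? ∣ A ∣)

  -- Induction on the clients. If the first client has an expendable neighbour, it is placed there.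
  -- Otherwise each of its neighbours of positive capacity is hit by a tight set of other clients.
  -- The union `B` of these sets is tight and hits them all, so adding the first client to `B` adds
  -- no capacity and violates Hall's condition.
  hall : ∀ {n} (N : Fin n → Fin p → Bool) (c : Fin p → ℕ) → Hall N c →
         ∃ λ (α : Fin n → Fin p) →
           (∀ v → N v (α v) ≡ true) × (∀ j → count (λ v → does (α v Fin.≟ j)) ≤ c j)
  hall {zero}  N c _ = (λ ()) , (λ ()) , λ _ → z≤n
  hall {suc n} N c h with Fin.any? (expendable? (N ∘ suc) c (h ∘ (outside ∷_)) (N zero))
  ... | yes (j , (Nj , 1≤cj) , ¬violated) with hall (N ∘ suc) (use (N ∘ suc) c (h ∘ (outside ∷_)) j)
                                              (λ A → ℕ.≮⇒≥ λ w< → ¬violated (A , w<))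
  ...   | α , N-α , α≤ = α′ , N-α′ , α′≤
    where
    α′ : Fin (suc n) → Fin p
    α′ zero    = j
    α′ (suc v) = α v
    N-α′ : ∀ v → N v (α′ v) ≡ true
    N-α′ zero    = Nj
    N-α′ (suc v) = N-α v
    α′≤ : ∀ i → count (λ v → does (α′ v Fin.≟ i)) ≤ c i
    α′≤ i = ℕ.≤-trans (ℕ.+-monoʳ-≤ [ does (j Fin.≟ i) ] (α≤ i)) (ℕ.≤-reflexive (ℕ.m+[n∸m]≡n δ≤))
      where
      δ≤ : [ does (j Fin.≟ i) ] ≤ c i
      δ≤ with j Fin.≟ i
      ... | yes refl = 1≤cj
      ... | no _     = z≤n
  hall {suc n} N c h | no none = contradiction (ℕ.≤-trans (h (inside ∷ B)) (ℕ.≤-trans saturated tB)) (ℕ.<-irrefl refl)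
    where
    N′ = N ∘ suc
    h′ = h ∘ (outside ∷_)
    cover : ∀ j → ∃ λ A → Tight N′ c A × (N zero j ≡ true → 1 ≤ c j → hit N′ A j ≡ true)
    cover j with (N zero j Bool.≟ true) ×-dec (1 ℕ.≤? c j)
    -- A position that cannot take the first client has nothing to be hit by; the empty set is a
    -- tight default.
    ... | no ¬cand = ⊥ , ℕ.≤-trans (ℕ.≤-reflexive (weight-⊥ N′ c)) z≤n ,
                     λ Nj 1≤cj → contradiction (Nj , 1≤cj) ¬cand
    ... | yes cand with anySubset? (λ A → weight N′ (use N′ c h′ j) A ℕ.<? ∣ A ∣)
    ...   | no ¬v = contradiction (j , cand , ¬v) none
    ...   | yes (A , w<) with violation⇒tight N′ c h′ j A w<
    ...     | tA , hitA = A , tA , λ _ _ → hitA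
    union = tight-⋃ N′ c h′ (proj₁ ∘ cover) (proj₁ ∘ proj₂ ∘ cover)
    B = proj₁ union
    tB = proj₁ (proj₂ union)
    saturated : weight N c (inside ∷ B) ≤ weight N′ c B
    saturated = sum-mono-≤ pointwise
      where
      pointwise : ∀ j → (if N zero j ∨ hit N′ B j then c j else 0) ≤ (if hit N′ B j then c j else 0)
      pointwise j with N zero j in Nj | c j in cj
      ... | false | _     = ℕ.≤-refl
      ... | true  | zero  = z≤n
      ... | true  | suc _ rewrite proj₂ (proj₂ union) j j (proj₂ (proj₂ (cover j)) Nj (subst (1 ≤_) (sym cj) (s≤s z≤n))) = ℕ.≤-refl

-- Lists

module _ {a} {A : Set a} where

  unique-⊆⇒length≤ : ∀ {xs ys : List A} → Unique xs → (∀ {v} → v ∈ xs → v ∈ ys) → length xs ≤ length ys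
  unique-⊆⇒length≤ {[]}     _           _   = z≤n
  unique-⊆⇒length≤ {x ∷ xs} u@(_ ∷ uxs) sub with ∈-∃++ (sub (here refl))
  ... | as , bs , refl = ℕ.≤-trans (s≤s (unique-⊆⇒length≤ uxs sub′)) (ℕ.≤-reflexive len)
    where
    len : suc (length (as ++ bs)) ≡ length (as ++ x ∷ bs)
    len = trans (cong suc (List.length-++ as))
            (trans (sym (ℕ.+-suc (length as) (length bs))) (sym (List.length-++ as)))
    sub′ : ∀ {v} → v ∈ xs → v ∈ as ++ bs
    sub′ v∈ with ∈-++⁻ as (sub (there v∈))
    ... | inj₁ v∈as          = ∈-++⁺ˡ v∈as
    ... | inj₂ (here refl)   = contradiction v∈ (Unique.Unique[x∷xs]⇒x∉xs u)
    ... | inj₂ (there v∈bs)  = ∈-++⁺ʳ as v∈bs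

  ∈-drop⁻ : ∀ i {xs : List A} {v} → v ∈ drop i xs → v ∈ xs
  ∈-drop⁻ i {xs} v∈ = subst (_ ∈_) (List.take++drop≡id i xs) (∈-++⁺ʳ (take i xs) v∈)

  ∈-take⁻ : ∀ i {xs : List A} {v} → v ∈ take i xs → v ∈ xs
  ∈-take⁻ i {xs} v∈ = subst (_ ∈_) (List.take++drop≡id i xs) (∈-++⁺ˡ v∈)

  ∈-take-or-drop : ∀ i {xs : List A} {v} → v ∈ xs → v ∈ take i xs ⊎ v ∈ drop i xs
  ∈-take-or-drop i {xs} v∈ = ∈-++⁻ (take i xs) (subst (_ ∈_) (sym (List.take++drop≡id i xs)) v∈)

  ∈-drop-++⁻ : ∀ i xs {ys : List A} {v} → length xs ≤ i → v ∈ drop i (xs ++ ys) → v ∈ ys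
  ∈-drop-++⁻ i       []       _       v∈ = ∈-drop⁻ i v∈
  ∈-drop-++⁻ (suc i) (x ∷ xs) (s≤s h) v∈ = ∈-drop-++⁻ i xs h v∈

  ∈-take-++⁻ : ∀ i xs {ys : List A} {v} → i ≤ length xs → v ∈ take i (xs ++ ys) → v ∈ xs
  ∈-take-++⁻ (suc i) (x ∷ xs) (s≤s h) (here refl) = here refl
  ∈-take-++⁻ (suc i) (x ∷ xs) (s≤s h) (there v∈)  = there (∈-take-++⁻ i xs h v∈)

  drop-++≡ : ∀ i (xs ys : List A) → drop i (xs ++ ys) ≡ drop i xs ++ drop (i ∸ length xs) ys
  drop-++≡ zero    []       ys = refl
  drop-++≡ (suc i) []       ys = refl
  drop-++≡ zero    (x ∷ xs) ys = refl
  drop-++≡ (suc i) (x ∷ xs) ys = drop-++≡ i xs ys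

  length-drop-≤ : ∀ i (xs : List A) j → length xs ≤ i + j → length (drop i xs) ≤ j
  length-drop-≤ i xs j h = subst (_≤ j) (sym (List.length-drop i xs))
    (ℕ.m≤n+o⇒m∸n≤o _ i h)

  unique-map-on : ∀ {b} {B : Set b} {f : A → B} {xs} → Unique xs →
                  (∀ {x y} → x ∈ xs → y ∈ xs → f x ≡ f y → x ≡ y) → Unique (map f xs)
  unique-map-on {xs = []}     []        inj = []
  unique-map-on {f = f} {xs = x ∷ xs} (x∉ ∷ u) inj =
    All.map⁺ (All.tabulate λ y∈ eq → All.lookup x∉ y∈ (inj (here refl) (there y∈) eq))
    ∷ unique-map-on u λ p q → inj (there p) (there q)

module _ {a p} {A : Set a} {P : Pred A p} (P? : Decidable P) where

  length-filter-tabulate : ∀ {n} (f : Fin n → A) → length (filter P? (tabulate f)) ≡ count (λ i → does (P? (f i)))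
  length-filter-tabulate {zero}  f = refl
  length-filter-tabulate {suc n} f with P? (f zero)
  ... | yes _ = cong suc (length-filter-tabulate (f ∘ suc))
  ... | no _  = length-filter-tabulate (f ∘ suc)

  length-concatMap-filter : ∀ {b} {B : Set b} (h : A → List B) {n} (f : Fin n → A) →
    length (concatMap h (filter P? (tabulate f))) ≡
    sumℕ (λ i → if does (P? (f i)) then length (h (f i)) else 0)
  length-concatMap-filter h {zero}  f = refl
  length-concatMap-filter h {suc n} f with P? (f zero)
  ... | yes _ = trans (List.length-++ (h (f zero))) (cong (length (h (f zero)) +_) (length-concatMap-filter h (f ∘ suc)))
  ... | no _  = length-concatMap-filter h (f ∘ suc)

-- Empty lists are not charged: in the application only a neighbour where clients wait brings a
-- reserved slot with it.
length-concatMap≤ : ∀ {a b} {A : Set a} {B : Set b} (h : A → List B) ℓ → (∀ x → length (h x) ≤ ℓ) →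
  ∀ xs → length (concatMap h xs) ≤ length (filter (λ x → 1 ℕ.≤? length (h x)) xs) * ℓ
length-concatMap≤ h ℓ h≤ []       = z≤n
length-concatMap≤ h ℓ h≤ (x ∷ xs) with h x in eq
... | []     = length-concatMap≤ h ℓ h≤ xs
... | y ∷ ys = ℕ.≤-trans (ℕ.≤-reflexive (List.length-++ (y ∷ ys)))
                 (ℕ.+-mono-≤ (subst (λ zs → length zs ≤ ℓ) eq (h≤ x)) (length-concatMap≤ h ℓ h≤ xs))

module _ {a} {A : Set a} where

  updateAt-elim : ∀ {n p} (P : Fin n → A → Set p) (h : Fin n → A) i {y} →
    P i y → (∀ j → j ≢ i → P j (h j)) → ∀ j → P j (updateAt h i (const y) j)
  updateAt-elim P h zero    Py Ph zero    = Py
  updateAt-elim P h zero    Py Ph (suc j) = Ph (suc j) λ ()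
  updateAt-elim P h (suc i) Py Ph zero    = Ph zero λ ()
  updateAt-elim P h (suc i) Py Ph (suc j) =
    updateAt-elim (P ∘ suc) (h ∘ suc) i Py (λ j j≢i → Ph (suc j) (j≢i ∘ Fin.suc-injective)) j

  -- Each side adds the entry that the other sum has in its place, which avoids subtraction in ℕ.
  sum-updateAt : ∀ {n} (f : A → ℕ) (h : Fin n → A) i y →
    f (h i) + sumℕ (f ∘ updateAt h i (const y)) ≡ f y + sumℕ (f ∘ h)
  sum-updateAt f h zero    y = swap (f (h zero)) (f y) _
    where
    swap : ∀ a b c → a + (b + c) ≡ b + (a + c)
    swap = solve-∀
  sum-updateAt f h (suc i) y = begin
    f (h (suc i)) + (f (h zero) + S′)  ≡⟨ swap (f (h (suc i))) (f (h zero)) S′ ⟩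
    f (h zero) + (f (h (suc i)) + S′)  ≡⟨ cong (f (h zero) +_) (sum-updateAt f (h ∘ suc) i y) ⟩
    f (h zero) + (f y + S)             ≡⟨ swap (f (h zero)) (f y) S ⟩
    f y + (f (h zero) + S)             ∎
    where
    open ≡-Reasoning
    S = sumℕ (f ∘ h ∘ suc)
    S′ = sumℕ (f ∘ updateAt (h ∘ suc) i (const y))
    swap : ∀ a b c → a + (b + c) ≡ b + (a + c)
    swap = solve-∀

-- The tree of monarchs

module Monarchs {n} (G : Graph n) (conn : Connected G) where
  open Graph G
  open Distance G conn

  V : Set
  V = Fin n

  within₁⇒≡⊎adj : ∀ {u v} → Within 1 u v → u ≡ v ⊎ Adj u v
  within₁⇒≡⊎adj {u} {v} w with dist G conn u v | geodesic u v
  within₁⇒≡⊎adj w             | zero  | []     = inj₁ refl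
  within₁⇒≡⊎adj w             | suc zero | e ∷ [] = inj₂ e
  within₁⇒≡⊎adj (s≤s ())      | suc (suc _) | _

  -- The newest monarch is the head and its parent lies in the tail, so going down the list retires
  -- leaves first. The root comes with an edge because every retiring monarch needs a neighbour `b`
  -- as its last slot.
  data Tree : List V → Set where
    root : ∀ {r b} → Adj r b → Tree (r ∷ [])
    grow : ∀ {M c b a p} → Tree M → Adj c b → Adj b a → Adj a p → p ∈ M →
           (∀ {m} → m ∈ M → ¬ Within 2 m c) → Tree (c ∷ M)

  tree-packed : ∀ {M} → Tree M → ∀ {m m′} → m ∈ M → m′ ∈ M → m ≢ m′ → ¬ Within 2 m m′
  tree-packed (root _)              (here refl) (here refl) m≢m  = contradiction refl m≢m
  tree-packed (grow T _ _ _ _ far)  (here refl) (here refl) m≢m  = contradiction refl m≢m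
  tree-packed (grow T _ _ _ _ far)  (here refl) (there q)   _    = far q ∘ within-sym
  tree-packed (grow T _ _ _ _ far)  (there p)   (here refl) _    = far p
  tree-packed (grow T _ _ _ _ far)  (there p)   (there q)        = tree-packed T p q

  tree-unique : ∀ {M} → Tree M → Unique M
  tree-unique (root _)             = [] ∷ []
  tree-unique (grow T _ _ _ _ far) =
    All.tabulate (λ m∈ eq → far m∈ (subst (λ z → Within 2 z _) eq within-refl)) ∷ tree-unique T

  tree-nonempty : ∀ {M} → Tree M → ∃ (_∈ M)
  tree-nonempty (root _)           = _ , here refl
  tree-nonempty (grow _ _ _ _ _ _) = _ , here refl

  Covered : List V → V → Set
  Covered M v = Any (λ m → Within 2 m v) M

  covered? : ∀ M → Decidable (Covered M)
  covered? M v = Any.any? (λ m → dist G conn m v ℕ.≤? 2) M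

  frontier : ∀ {M d u v} → Walk G d u v → ¬ Covered M u → Covered M v →
             ∃₂ λ u′ v′ → Adj u′ v′ × ¬ Covered M u′ × Covered M v′
  frontier []      ¬cu cv = contradiction cv ¬cu
  frontier {M} (_∷_ {v = w} e p) ¬cu cv with covered? M w
  ... | yes cw = _ , _ , e , ¬cu , cw
  ... | no ¬cw = frontier p ¬cw cv

  -- On a walk from `v` to a monarch some edge leads from an uncovered `c` to a vertex covered by
  -- some `p`. Then `c` is within 3 of `p` but not within 2, so the geodesic is the required path of
  -- exactly three edges.
  extend : ∀ {M v} → Tree M → ¬ Covered M v → ∃ λ c → Tree (c ∷ M)
  extend {M} {v} T ¬cv with tree-nonempty T
  ... | r , r∈ with frontier (proj₂ (conn v r)) ¬cv (lose r∈ within-refl)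
  ...   | c , w , e , ¬cc , cw with find cw
  ...     | p , p∈ , pw with dist G conn c p in eq | geodesic c p
                           | within-trans (adj⇒within e) (within-sym pw)
  ...       | 0 | _ | _ = contradiction (lose p∈ (within-sym (subst (_≤ 2) (sym eq) z≤n))) ¬cc
  ...       | 1 | _ | _ = contradiction (lose p∈ (within-sym (subst (_≤ 2) (sym eq) (s≤s z≤n)))) ¬cc
  ...       | 2 | _ | _ = contradiction (lose p∈ (within-sym (subst (_≤ 2) (sym eq) ℕ.≤-refl))) ¬cc
  ...       | 3 | e₁ ∷ e₂ ∷ e₃ ∷ [] | _ = c , grow T e₁ e₂ e₃ p∈ λ m∈ w → ¬cc (lose m∈ w)
  ...       | suc (suc (suc (suc _))) | _ | s≤s (s≤s (s≤s ()))

  -- The fuel bounds how many monarchs can still be added: they are distinct, so there are never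
  -- more than `n`.
  spanning-from : ∀ fuel {M} → Tree M → n ≤ fuel + length M → ∃ λ M′ → Tree M′ × ∀ v → Covered M′ v
  spanning-from fuel {M} T h with Fin.any? (¬? ∘ covered? M)
  ... | no ¬unc = M , T , λ v → decidable-stable (covered? M v) (¬unc ∘ (v ,_))
  ... | yes (v , ¬cv) with extend T ¬cv
  spanning-from zero {M} T h | yes _ | c , T′ =
    contradiction (ℕ.≤-trans (unique-⊆⇒length≤ (tree-unique T′) λ {v} _ → ∈-allFin v)
                    (ℕ.≤-trans (ℕ.≤-reflexive (List.length-tabulate id)) h))
                  (ℕ.<-irrefl refl)
  spanning-from (suc fuel) {M} T h | yes _ | c , T′ =
    spanning-from fuel T′ (ℕ.≤-trans h (ℕ.≤-reflexive (sym (ℕ.+-suc fuel (length M)))))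

  spanning-tree : ∀ {r b} → Adj r b → ∃ λ M → Tree M × ∀ v → Covered M v
  spanning-tree e = spanning-from n (root e) (ℕ.m≤m+n n 1)

  -- A partition into clusters around the monarchs. A monarch within 1 takes precedence, and packing
  -- makes it unique; so a cluster contains the whole closed neighbourhood of its monarch, and slots
  -- that different monarchs open in their own clusters never collide.
  record Clustering (M : List V) : Set where
    field
      κ        : V → V
      κ∈M      : ∀ v → κ v ∈ M
      κ-within : ∀ v → Within 2 (κ v) v
      κ-near   : ∀ {m v} → m ∈ M → Within 1 m v → κ v ≡ m

  clustering : ∀ {M} → Tree M → (∀ v → Covered M v) → Clustering M
  clustering {M} T cov = record
    { κ        = λ v → proj₁ (pick v)
    ; κ∈M      = λ v → proj₁ (proj₂ (pick v))
    ; κ-within = λ v → proj₁ (proj₂ (proj₂ (pick v)))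
    ; κ-near   = λ {m} {v} → proj₂ (proj₂ (proj₂ (pick v))) {m}
    }
    where
    pick : ∀ v → ∃ λ c → c ∈ M × Within 2 c v × (∀ {m} → m ∈ M → Within 1 m v → c ≡ m)
    pick v with Any.any? (λ m → dist G conn m v ℕ.≤? 1) M
    ... | yes near with find near
    ...   | c , c∈ , cv = c , c∈ , ℕ.m≤n⇒m≤1+n cv , λ {m} m∈ mv → case c Fin.≟ m of λ
              { (yes eq) → eq
              ; (no c≢m) → contradiction (within-trans cv (within-sym mv)) (tree-packed T c∈ m∈ c≢m) }
    pick v | no ¬near with find (cov v)
    ... | c , c∈ , cv = c , c∈ , cv , λ m∈ mv → contradiction (lose m∈ mv) ¬near

-- Rounding

-- The clients are served from centre in the soft solution and from slot in the hard one.
module _ {n : ℕ} where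

  record Group : Set where
    constructor group
    field
      centre slot : Fin n
      clients     : List (Fin n)

module Dealing {n} (ℓ : ℕ) (c : Fin n) where
  private V = Fin n
  open Group

  -- Consecutive chunks of `ℓ` clients go to consecutive slots, so the order of both lists decides
  -- who is served where.
  deal : ℕ → List V → List V → List Group
  deal zero    ss       Z = []
  -- A default, out of reach whenever `q ≤ length ss`.
  deal (suc q) []       Z = []
  deal (suc q) (s ∷ ss) Z = group c s (take ℓ Z) ∷ deal q ss (drop ℓ Z)

  deal-slots : ∀ {q ss} Z → q ≤ length ss → map slot (deal q ss Z) ≡ take q ss
  deal-slots {zero}               Z h       = refl
  deal-slots {suc q} {ss = s ∷ _} Z (s≤s h) = cong (s ∷_) (deal-slots (drop ℓ Z) h)

  deal-covers : ∀ {q ss} Z {v} → q ≤ length ss → v ∈ Z →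
                Any (λ g → v ∈ clients g) (deal q ss Z) ⊎ v ∈ drop (q * ℓ) Z
  deal-covers {zero}           Z h       v∈ = inj₂ v∈
  deal-covers {suc q} {s ∷ ss} Z (s≤s h) v∈ with ∈-take-or-drop ℓ v∈
  ... | inj₁ v∈t = inj₁ (here v∈t)
  ... | inj₂ v∈d with deal-covers (drop ℓ Z) h v∈d
  ...   | inj₁ any = inj₁ (there any)
  ...   | inj₂ v∈r = inj₂ (subst (_ ∈_) (List.drop-drop ℓ (q * ℓ) Z) v∈r)

  DealtTo : (V → V → Set) → Group → Set
  DealtTo Q g = length (clients g) ≤ ℓ × (∀ v → v ∈ clients g → Q (slot g) v) × centre g ≡ c

  length-take≤ : ∀ (Z : List V) → length (take ℓ Z) ≤ ℓ
  length-take≤ Z = subst (_≤ ℓ) (sym (List.length-take ℓ Z)) (ℕ.m⊓n≤m ℓ _)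

  -- R only fills chunks that go to slots in S₁.
  deal-within : ∀ {Q : V → V → Set} q S₁ S₂ R W → length R ≤ length S₁ * ℓ →
    (∀ {s v} → s ∈ S₁ → v ∈ R → Q s v) → (∀ {s v} → s ∈ S₁ ++ S₂ → v ∈ W → Q s v) →
    All (DealtTo Q) (deal q (S₁ ++ S₂) (R ++ W))
  deal-within zero    S₁       S₂       R  W _ QR QW = []
  deal-within (suc q) []       []       R  W _ QR QW = []
  deal-within (suc q) []       (s ∷ S₂) [] W _ QR QW =
    (length-take≤ W , (λ _ v∈ → QW (here refl) (∈-take⁻ ℓ v∈)) , refl)
    ∷ deal-within q [] S₂ [] (drop ℓ W) z≤n (λ ()) λ s∈ v∈ → QW (there s∈) (∈-drop⁻ ℓ v∈)
  deal-within {Q} (suc q) (s ∷ S₁) S₂ R W h QR QW =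
    (length-take≤ (R ++ W) , first , refl)
    ∷ subst (λ Z → All (DealtTo Q) (deal q (S₁ ++ S₂) Z)) (sym (drop-++≡ ℓ R W))
        (deal-within q S₁ S₂ (drop ℓ R) (drop (ℓ ∸ length R) W) (length-drop-≤ ℓ R _ h)
          (λ s∈ v∈ → QR (there s∈) (∈-drop⁻ ℓ v∈))
          (λ s∈ v∈ → QW (there s∈) (∈-drop⁻ (ℓ ∸ length R) v∈)))
    where
    first : ∀ v → v ∈ take ℓ (R ++ W) → Q s v
    first _ v∈ with ∈-++⁻ R (∈-take⁻ ℓ v∈)
    ... | inj₁ v∈R = QR (here refl) v∈R
    ... | inj₂ v∈W = QW (here refl) v∈W

-- A retiring monarch has r received, e own free and d lodged clients, and s own and g
-- handed-over slots.
module Numbers (ℓ : ℕ) .{{_ : NonZero ℓ}} (2≤ℓ : 2 ≤ ℓ) where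

  -- The first centre is paid for by the `ℓ` set aside for the monarch, each further one by `ℓ` of
  -- the `w` received and free clients.
  rounds : ℕ → ℕ
  rounds w = suc (w / ℓ)

  -- This amounts to (s - 1)(ℓ - 1) ≥ 1, and is where capacity at least 2 meets a cluster of at
  -- least two vertices.
  s+ℓ≤s*ℓ : ∀ {s} → 2 ≤ s → s + ℓ ≤ s * ℓ
  s+ℓ≤s*ℓ {suc s} (s≤s 1≤s) = begin
    suc s + ℓ  ≡⟨ ℕ.+-comm (suc s) ℓ ⟩
    ℓ + suc s  ≤⟨ ℕ.+-monoʳ-≤ ℓ (ℕ.+-monoˡ-≤ s 1≤s) ⟩
    ℓ + (s + s) ≡⟨ cong (λ z → ℓ + (s + z)) (ℕ.+-identityʳ s) ⟨
    ℓ + 2 * s  ≤⟨ ℕ.+-monoʳ-≤ ℓ (ℕ.*-monoˡ-≤ s 2≤ℓ) ⟩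
    ℓ + ℓ * s  ≡⟨ cong (ℓ +_) (ℕ.*-comm ℓ s) ⟩
    ℓ + s * ℓ  ∎
    where open ℕ.≤-Reasoning

  module _ {r e s g} (r≤ : r ≤ g * ℓ) (e≤ : e ≤ s) (2≤s : 2 ≤ s) where
    open ℕ.≤-Reasoning

    private
      -- The received clients fit into the handed-over slots, and the `s` own slots hold at most `s`
      -- free clients with room for `ℓ` more.
      load≤ : r + e + ℓ ≤ (s + g) * ℓ
      load≤ = begin
        r + e + ℓ      ≡⟨ ℕ.+-assoc r e ℓ ⟩
        r + (e + ℓ)    ≤⟨ ℕ.+-mono-≤ r≤ (ℕ.≤-trans (ℕ.+-monoˡ-≤ ℓ e≤) (s+ℓ≤s*ℓ 2≤s)) ⟩
        g * ℓ + s * ℓ  ≡⟨ ℕ.+-comm (g * ℓ) (s * ℓ) ⟩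
        s * ℓ + g * ℓ  ≡⟨ ℕ.*-distribʳ-+ ℓ s g ⟨
        (s + g) * ℓ    ∎

    enough-slots : rounds (r + e) ≤ s + g
    enough-slots = ℕ.m<n*o⇒m/o<n (ℕ.<-≤-trans (ℕ.m<m+n (r + e) (ℕ.≤-trans (s≤s z≤n) 2≤ℓ)) load≤)

    -- All clients, the lodged ones included, fit into all the slots; so if the rounds leave a
    -- client over, they leave a slot over as well.
    spare-slot : ∀ {d} → d ≤ ℓ → rounds (r + e) * ℓ < r + e + d → rounds (r + e) < s + g
    spare-slot {d} d≤ more = ℕ.*-cancelʳ-< _ _ _
      (ℕ.<-≤-trans more (ℕ.≤-trans (ℕ.+-monoʳ-≤ (r + e) d≤) load≤))

  -- The first round makes up for the at most `ℓ` lodged clients, so at most `w % ℓ` clients remain.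
  -- Hence the `w` clients also pay for the extra centres and the remainder together.
  leftover : ∀ w d → d ≤ ℓ → w + d ∸ rounds w * ℓ < ℓ × (w / ℓ) * ℓ + (w + d ∸ rounds w * ℓ) ≤ w
  leftover w d d≤ = ℕ.≤-<-trans left≤ (ℕ.m%n<n w ℓ) , (begin
    (w / ℓ) * ℓ + (w + d ∸ rounds w * ℓ) ≤⟨ ℕ.+-monoʳ-≤ ((w / ℓ) * ℓ) left≤ ⟩
    (w / ℓ) * ℓ + w % ℓ                  ≡⟨ ℕ.+-comm ((w / ℓ) * ℓ) (w % ℓ) ⟩
    w % ℓ + (w / ℓ) * ℓ                  ≡⟨ ℕ.m≡m%n+[m/n]*n w ℓ ⟨
    w                                    ∎)
    where
    open ℕ.≤-Reasoning
    left≤ : w + d ∸ rounds w * ℓ ≤ w % ℓ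
    left≤ = ℕ.m≤n+o⇒m∸n≤o _ _ (begin
      w + d                          ≤⟨ ℕ.+-monoʳ-≤ w d≤ ⟩
      w + ℓ                          ≡⟨ ℕ.+-comm w ℓ ⟩
      ℓ + w                          ≡⟨ cong (ℓ +_) (ℕ.m≡m%n+[m/n]*n w ℓ) ⟩
      ℓ + (w % ℓ + (w / ℓ) * ℓ)      ≡⟨ cong (ℓ +_) (ℕ.+-comm (w % ℓ) _) ⟩
      ℓ + ((w / ℓ) * ℓ + w % ℓ)      ≡⟨ ℕ.+-assoc ℓ _ _ ⟨
      rounds w * ℓ + w % ℓ           ∎)

∈-resp-≡ : ∀ {a} {A : Set a} {xs ys : List A} {v} → xs ≡ ys → v ∈ xs → v ∈ ys
∈-resp-≡ refl v∈ = v∈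

slot-++⁻ : ∀ {n} (gs {hs} : List (Group {n})) {s} → s ∈ map Group.slot (gs ++ hs) →
           s ∈ map Group.slot gs ⊎ s ∈ map Group.slot hs
slot-++⁻ gs {hs} s∈ = ∈-++⁻ (map Group.slot gs) (∈-resp-≡ (List.map-++ Group.slot gs hs) s∈)

-- α v = suc m lodges v with the monarch m, and α v = zero leaves v free.
module Rounding {n} (G : Graph n) (conn : Connected G)
  {M₀ : List (Fin n)} (cl : Monarchs.Clustering G conn M₀)
  (ℓ : ℕ) .{{_ : NonZero ℓ}} (2≤ℓ : 2 ≤ ℓ) (k : ℕ)
  (α : Fin n → Fin (suc n))
  (α-near : ∀ {v m} → α v ≡ suc m → m ∈ M₀ × Distance.Within G conn 2 m v)
  (α-load : ∀ m → length (filter (λ v → α v Fin.≟ suc m) (allFin n)) ≤ ℓ)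
  (α-free : length M₀ * ℓ + length (filter (λ v → α v Fin.≟ zero) (allFin n)) ≤ k * ℓ)
  (M₀-unique : Unique M₀)
  where

  open Graph G
  open Monarchs G conn
  open Distance G conn
  open Group
  open Clustering cl
  open Numbers ℓ 2≤ℓ

  within-≤ : ∀ {d e u v} → d ≤ e → Within d u v → Within e u v
  within-≤ d≤e w = ℕ.≤-trans w d≤e

  domain? : ∀ m → Decidable (λ v → α v ≡ suc m)
  domain? m v = α v Fin.≟ suc m

  free? : Decidable (λ v → α v ≡ zero)
  free? v = α v Fin.≟ zero

  freeAt? : ∀ m → Decidable (λ v → α v ≡ zero × κ v ≡ m)
  freeAt? m v = free? v ×-dec κ v Fin.≟ m

  domain free : V → List V
  domain m = filter (domain? m) (allFin n)
  free m = filter (freeAt? m) (allFin n)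

  domain-within : ∀ {m v} → v ∈ domain m → Within 2 m v
  domain-within {m} v∈ = proj₂ (α-near (proj₂ (∈-filter⁻ (domain? m) {xs = allFin n} v∈)))

  free-κ : ∀ {m v} → v ∈ free m → κ v ≡ m
  free-κ {m} v∈ = proj₂ (proj₂ (∈-filter⁻ (freeAt? m) {xs = allFin n} v∈))

  κ-within′ : ∀ {m v} → κ v ≡ m → Within 2 m v
  κ-within′ {v = v} refl = κ-within v

  -- The monarch at whose retirement `v` is first dealt with; a free client goes by its cluster.
  home : V → V
  home v with α v
  ... | zero  = κ v
  ... | suc m = m

  home-∈ : ∀ v → v ∈ free (home v) ⊎ v ∈ domain (home v)
  home-∈ v with α v in eq
  ... | zero  = inj₁ (∈-filter⁺ (freeAt? (κ v)) (∈-allFin v) (eq , refl))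
  ... | suc m = inj₂ (∈-filter⁺ (domain? m) (∈-allFin v) eq)

  home-∈M₀ : ∀ v → home v ∈ M₀
  home-∈M₀ v with α v in eq
  ... | zero  = κ∈M v
  ... | suc m = proj₁ (α-near eq)

  allFree : List V → List V
  allFree = concatMap free

  allFree-κ : ∀ {M v} → v ∈ allFree M → κ v ∈ M
  allFree-κ {m ∷ M} v∈ with ∈-++⁻ (free m) v∈
  ... | inj₁ p = here (free-κ p)
  ... | inj₂ p = there (allFree-κ p)

  allFree-zero : ∀ {M v} → v ∈ allFree M → α v ≡ zero
  allFree-zero {m ∷ M} v∈ with ∈-++⁻ (free m) v∈
  ... | inj₁ p = proj₁ (proj₂ (∈-filter⁻ (freeAt? m) {xs = allFin n} p))
  ... | inj₂ p = allFree-zero {M} p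

  allFree-unique : ∀ {M} → Unique M → Unique (allFree M)
  allFree-unique []          = []
  allFree-unique {m ∷ M} uM@(_ ∷ u) = Unique.++⁺ (Unique.filter⁺ (freeAt? m) (Unique.allFin⁺ n)) (allFree-unique u)
    λ (p , q) → Unique.Unique[x∷xs]⇒x∉xs uM (subst (_∈ M) (free-κ p) (allFree-κ {M} q))

  -- The two radii belong to the soft and the hard solution, which are read off from the same
  -- groups.
  Good : Group → Set
  Good g = length (clients g) ≤ ℓ ×
           (∀ v → v ∈ clients g → Within 5 (centre g) v × Within 6 (slot g) v)

  Served : List Group → V → Set
  Served gs v = Any (λ g → v ∈ clients g) gs

  record Result : Set where
    field
      gs     : List Group
      good   : All Good gs
      unique : Unique (map slot gs)
      size   : length gs ≤ k
      served : ∀ v → Served gs v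

  -- The slot is meaningful only when some client is waiting.
  Pending : Set
  Pending = V × List V

  Live : Pending → Set
  Live (_ , vs) = 1 ≤ length vs

  waiting : Pending → ℕ
  waiting (_ , vs) = length vs

  -- `parent` is a monarch yet to retire, which will collect the clients waiting at `a`; `done`
  -- keeps `s` out of the clusters whose slots are still to be dealt.
  record Reserved (M : List V) (gs : List Group) (a s : V) : Set where
    field
      parent : ∃ λ p → p ∈ M × Adj p a
      adj    : Adj a s
      done   : κ s ∉ M
      fresh  : s ∉ map slot gs

  -- The 4 is the path a - b - c to the retired monarch plus the 2 from there to a client lodged
  -- with it. One more step reaches the parent or the reserved slot.
  PendingOk : List V → List Group → V → Pending → Set
  PendingOk M gs a (s , vs) =
    length vs < ℓ × (∀ v → v ∈ vs → Within 4 a v) × (1 ≤ length vs → Reserved M gs a s)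

  Distinct : (V → Pending) → Set
  Distinct store = ∀ a a′ → Live (store a) → Live (store a′) → proj₁ (store a) ≡ proj₁ (store a′) → a ≡ a′

  -- `M` lists the monarchs yet to retire and `f` the clients in transit from the latest one to its
  -- parent. A client is untouched until its `home` retires; then it waits, is in transit, or is
  -- served.
  record State (M : List V) (f : List V) : Set where
    field
      store     : V → Pending
      gs        : List Group
      pendingOk : ∀ a → PendingOk M gs a (store a)
      distinct  : Distinct store
      good      : All Good gs
      unique    : Unique (map slot gs)
      done      : ∀ {s} → s ∈ map slot gs → κ s ∉ M
      covered   : ∀ v → home v ∈ M ⊎ (∃ λ a → v ∈ proj₂ (store a)) ⊎ v ∈ f ⊎ Served gs v
      -- Each monarch still to retire has ℓ set aside for its first centre.
      budget    : (length gs + length M) * ℓ + (sumℕ (waiting ∘ store) + (length f + length (allFree M))) ≤ k * ℓ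

  NewSlot : ∀ {M f} → State M f → V → Set
  NewSlot S b = b ∉ map slot gs × (∀ a → Live (store a) → proj₁ (store a) ≢ b)
    where open State S

  initial : State M₀ []
  initial = record
    { store     = λ a → a , []
    ; gs        = []
    ; pendingOk = λ a → ℕ.≤-trans (s≤s z≤n) 2≤ℓ , (λ _ ()) , λ ()
    ; distinct  = λ _ _ ()
    ; good      = []
    ; unique    = []
    ; done      = λ ()
    ; covered   = λ v → inj₁ (home-∈M₀ v)
    ; budget    = ℕ.≤-trans (ℕ.+-monoʳ-≤ (length M₀ * ℓ)
        (ℕ.≤-trans (ℕ.≤-reflexive (cong (_+ length (allFree M₀)) (sum-zeroℕ {n} λ _ → refl)))
          (unique-⊆⇒length≤ (allFree-unique M₀-unique)
            λ {v} v∈ → ∈-filter⁺ free? (∈-allFin v) (allFree-zero {M₀} v∈)))) α-free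
    }

  -- Retiring one monarch

  module Retire {M c b} (c∈M₀ : c ∈ M₀) (c∉M : c ∉ M) (cb : Adj c b) (S : State (c ∷ M) []) where
    open State S

    nbrs others far reused front back slots cluster R Z : List V
    nbrs = filter (adj? c) (allFin n)
    others = filter (λ u → ¬? (u Fin.≟ b)) nbrs
    far = filter (λ u → κ u Fin.≟ c ×-dec ¬? (dist G conn c u ℕ.≤? 1)) (allFin n)

    live? : Decidable (Live ∘ store)
    live? a = 1 ℕ.≤? waiting (store a)

    reused = map (proj₁ ∘ store) (filter live? nbrs)
    front = c ∷ others
    back = far ++ reused
    slots = (front ++ back) ++ b ∷ []
    cluster = front ++ far ++ b ∷ []
    R = concatMap (proj₂ ∘ store) nbrs
    Z = R ++ (free c ++ domain c)

    w q : ℕ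
    w = length R + length (free c)
    q = rounds w

    nbr⁻ : ∀ {u} → u ∈ nbrs → Adj c u
    nbr⁻ u∈ = proj₂ (∈-filter⁻ (adj? c) {xs = allFin n} u∈)

    nbr⁺ : ∀ {u} → Adj c u → u ∈ nbrs
    nbr⁺ e = ∈-filter⁺ (adj? c) (∈-allFin _) e

    other⁻ : ∀ {u} → u ∈ others → Adj c u × u ≢ b
    other⁻ u∈ = let p , u≢b = ∈-filter⁻ (λ u → ¬? (u Fin.≟ b)) {xs = nbrs} u∈ in nbr⁻ p , u≢b

    far⁻ : ∀ {u} → u ∈ far → κ u ≡ c × ¬ Within 1 c u
    far⁻ u∈ = proj₂ (∈-filter⁻ (λ u → κ u Fin.≟ c ×-dec ¬? (dist G conn c u ℕ.≤? 1)) {xs = allFin n} u∈)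

    reused⁻ : ∀ {s} → s ∈ reused → ∃ λ a → Adj c a × Live (store a) × s ≡ proj₁ (store a)
    reused⁻ s∈ with ∈-map⁻ (proj₁ ∘ store) s∈
    ... | a , a∈ , eq with ∈-filter⁻ live? {xs = nbrs} a∈
    ...   | a∈n , la = a , nbr⁻ a∈n , la , eq

    reserved : ∀ {a} → Live (store a) → Reserved (c ∷ M) gs a (proj₁ (store a))
    reserved {a} = proj₂ (proj₂ (pendingOk a))

    κ-adj : ∀ {u} → Adj c u → κ u ≡ c
    κ-adj e = κ-near c∈M₀ (adj⇒within e)

    c≢ : ∀ {u} → Adj c u → c ≢ u
    c≢ e refl = adj-irrefl refl e

    in-front : ∀ {s} → s ∈ front → Within 1 c s
    in-front (here refl) = within-refl
    in-front (there s∈)  = adj⇒within (proj₁ (other⁻ s∈))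

    -- A slot lies in the cluster of `c`, or was reserved at a neighbour of `c` when an earlier
    -- monarch retired.
    data Origin (s : V) : Set where
      own    : κ s ≡ c → Origin s
      passed : ∀ a → Adj c a → Live (store a) → s ≡ proj₁ (store a) → Origin s

    front-own : ∀ {s} → s ∈ front → κ s ≡ c
    front-own = κ-near c∈M₀ ∘ in-front

    origin : ∀ {s} → s ∈ slots → Origin s
    origin s∈ with ∈-++⁻ (front ++ back) s∈
    ... | inj₂ (here refl) = own (κ-adj cb)
    ... | inj₁ s∈′ with ∈-++⁻ front s∈′
    ...   | inj₁ s∈f = own (front-own s∈f)
    ...   | inj₂ s∈b with ∈-++⁻ far s∈b
    ...     | inj₁ s∈far = own (proj₁ (far⁻ s∈far))
    ...     | inj₂ s∈r = let a , ca , la , eq = reused⁻ s∈r in passed a ca la eq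

    origin-within : ∀ {s} → Origin s → Within 2 c s
    origin-within (own κs≡c)          = κ-within′ κs≡c
    origin-within (passed a ca la refl) =
      within-trans (adj⇒within ca) (adj⇒within (Reserved.adj (reserved la)))

    origin-done : ∀ {s} → Origin s → κ s ∉ M
    origin-done (own refl)             = c∉M
    origin-done (passed a ca la refl)  = Reserved.done (reserved la) ∘ there

    -- Opened slots avoid the clusters of monarchs yet to retire, `c` among them until now; a
    -- reserved slot is fresh by the invariant.
    origin-fresh : ∀ {s} → Origin s → s ∉ map slot gs
    origin-fresh (own κs≡c)            s∈ = done s∈ (here κs≡c)
    origin-fresh (passed a ca la refl) = Reserved.fresh (reserved la)

    nbrs-unique : Unique nbrs
    nbrs-unique = Unique.filter⁺ (adj? c) (Unique.allFin⁺ n)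

    others-unique : Unique others
    others-unique = Unique.filter⁺ (λ u → ¬? (u Fin.≟ b)) nbrs-unique

    front-unique : Unique front
    front-unique = All.tabulate (λ u∈ → c≢ (proj₁ (other⁻ u∈))) ∷ others-unique

    reused-done : ∀ {s} → s ∈ reused → κ s ≢ c
    reused-done s∈ eq with reused⁻ s∈
    ... | a , _ , la , refl = Reserved.done (reserved la) (here eq)

    back-unique : Unique back
    back-unique = Unique.++⁺ (Unique.filter⁺ _ (Unique.allFin⁺ n))
      (unique-map-on (Unique.filter⁺ live? nbrs-unique) λ {a} {a′} p p′ →
        distinct a a′ (proj₂ (∈-filter⁻ live? {xs = nbrs} p)) (proj₂ (∈-filter⁻ live? {xs = nbrs} p′)))
      λ (p , p′) → reused-done p′ (proj₁ (far⁻ p))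

    front-back-unique : Unique (front ++ back)
    front-back-unique = Unique.++⁺ front-unique back-unique λ (p , p′) → case ∈-++⁻ far p′ of λ
      { (inj₁ f) → proj₂ (far⁻ f) (in-front p)
      ; (inj₂ r) → reused-done r (front-own p) }

    b∉front-back : b ∉ front ++ back
    b∉front-back b∈ with ∈-++⁻ front b∈
    ... | inj₁ (here refl) = adj-irrefl refl cb
    ... | inj₁ (there p)   = proj₂ (other⁻ p) refl
    ... | inj₂ p with ∈-++⁻ far p
    ...   | inj₁ f = proj₂ (far⁻ f) (adj⇒within cb)
    ...   | inj₂ r = reused-done r (κ-adj cb)

    slots-unique : Unique slots
    slots-unique = Unique.++⁺ front-back-unique ([] ∷ []) λ { (p , here refl) → b∉front-back p }

    r≤ : length R ≤ length (filter live? nbrs) * ℓ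
    r≤ = length-concatMap≤ (proj₂ ∘ store) ℓ (λ a → ℕ.<⇒≤ (proj₁ (pendingOk a))) nbrs

    nbrs≤front : length nbrs ≤ length front
    nbrs≤front = unique-⊆⇒length≤ {ys = b ∷ others} nbrs-unique λ {u} u∈ → case u Fin.≟ b of λ
      { (yes refl) → here refl
      ; (no u≢b)   → there (∈-filter⁺ (λ u → ¬? (u Fin.≟ b)) u∈ u≢b) }

    -- Fewer than `ℓ` clients wait at each neighbour of `c`, and `front` has as many slots as there
    -- are neighbours, `c` standing in for `b`.
    R≤front : length R ≤ length front * ℓ
    R≤front = ℕ.≤-trans r≤ (ℕ.*-monoˡ-≤ ℓ (ℕ.≤-trans (List.length-filter live? nbrs) nbrs≤front))

    own∈cluster : ∀ {u} → κ u ≡ c → u ∈ cluster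
    own∈cluster {u} κu≡c with dist G conn c u ℕ.≤? 1
    ... | no ¬w = ∈-++⁺ʳ front (∈-++⁺ˡ (∈-filter⁺ _ (∈-allFin u) (κu≡c , ¬w)))
    ... | yes wi with within₁⇒≡⊎adj wi
    ...   | inj₁ refl = here refl
    ...   | inj₂ e with u Fin.≟ b
    ...     | yes refl = ∈-++⁺ʳ front (∈-++⁺ʳ far (here refl))
    ...     | no u≢b   = there (∈-++⁺ˡ (∈-filter⁺ _ (nbr⁺ e) u≢b))

    -- The free clients of `c` are themselves vertices of its cluster, each of which is one of its
    -- own slots.
    free≤cluster : length (free c) ≤ length cluster
    free≤cluster = unique-⊆⇒length≤ (Unique.filter⁺ (freeAt? c) (Unique.allFin⁺ n)) (own∈cluster ∘ free-κ)

    length-cluster : length cluster ≡ length front + (length far + 1)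
    length-cluster = trans (List.length-++ front) (cong (length front +_) (List.length-++ far))

    2≤cluster : 2 ≤ length cluster
    2≤cluster = subst (2 ≤_) (sym length-cluster)
      (ℕ.+-mono-≤ {1} {length front} (s≤s z≤n) (ℕ.m≤n+m 1 (length far)))

    length-slots : length slots ≡ length cluster + length (filter live? nbrs)
    length-slots = begin
      length slots                               ≡⟨ List.length-++ (front ++ back) ⟩
      length (front ++ back) + 1                 ≡⟨ cong (_+ 1) (List.length-++ front) ⟩
      length front + length back + 1             ≡⟨ cong (λ z → length front + z + 1) (List.length-++ far) ⟩
      length front + (length far + length reused) + 1
        ≡⟨ cong (λ z → length front + (length far + z) + 1) (List.length-map _ (filter live? nbrs)) ⟩
      length front + (length far + length (filter live? nbrs)) + 1
        ≡⟨ shuffle (length front) (length far) (length (filter live? nbrs)) ⟩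
      length front + (length far + 1) + length (filter live? nbrs)
        ≡⟨ cong (_+ length (filter live? nbrs)) length-cluster ⟨
      length cluster + length (filter live? nbrs) ∎
      where
      open ≡-Reasoning
      shuffle : ∀ x y z → x + (y + z) + 1 ≡ x + (y + 1) + z
      shuffle = solve-∀

    q≤slots : q ≤ length slots
    q≤slots = subst (q ≤_) (sym length-slots) (enough-slots r≤ free≤cluster 2≤cluster)

    f : List V
    f = drop (q * ℓ) Z

    length-Z : length Z ≡ w + length (domain c)
    length-Z = trans (List.length-++ R) (trans (cong (length R +_) (List.length-++ (free c)))
                 (sym (ℕ.+-assoc (length R) _ _)))

    length-f : length f ≡ w + length (domain c) ∸ q * ℓ
    length-f = trans (List.length-drop (q * ℓ) Z) (cong (_∸ q * ℓ) length-Z)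

    f<ℓ : length f < ℓ
    f<ℓ = subst (_< ℓ) (sym length-f) (proj₁ (leftover w _ (α-load c)))

    f-spend : (w / ℓ) * ℓ + length f ≤ w
    f-spend = subst (λ z → (w / ℓ) * ℓ + z ≤ w) (sym length-f) (proj₂ (leftover w _ (α-load c)))

    q*ℓ≥w : w ≤ q * ℓ
    q*ℓ≥w = ℕ.≤-trans (ℕ.≤-reflexive (ℕ.m≡m%n+[m/n]*n w ℓ)) (ℕ.+-monoˡ-≤ _ (ℕ.<⇒≤ (ℕ.m%n<n w ℓ)))

    -- The `q` rounds have room for all `w` received and free clients, which precede the lodged ones
    -- in `Z`.
    f-domain : ∀ {v} → v ∈ f → v ∈ domain c
    f-domain v∈ = ∈-drop-++⁻ (q * ℓ) (R ++ free c)
      (subst (_≤ q * ℓ) (sym (List.length-++ R)) q*ℓ≥w)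
      (subst (λ z → _ ∈ drop (q * ℓ) z) (sym (List.++-assoc R (free c) (domain c))) v∈)

    -- A client left over means a slot left over, so the first `q` slots stop short of `b`, the last
    -- one.
    spare : 1 ≤ length f → q ≤ length (front ++ back)
    spare 1≤f = ℕ.s≤s⁻¹ (subst (suc q ≤_) len
      (spare-slot r≤ free≤cluster 2≤cluster (α-load c)
        (ℕ.m∸n≢0⇒n<m λ eq → case subst (1 ≤_) (trans length-f eq) 1≤f of λ ())))
      where
      len : length cluster + length (filter live? nbrs) ≡ suc (length (front ++ back))
      len = trans (sym length-slots) (trans (List.length-++ (front ++ back)) (ℕ.+-comm _ 1))

    open Dealing ℓ c

    dealt : List Group
    dealt = deal q slots Z

    dealt-slots : map slot dealt ≡ take q slots
    dealt-slots = deal-slots Z q≤slots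

    dealt-origin : ∀ {s} → s ∈ map slot dealt → Origin s
    dealt-origin s∈ = origin (∈-take⁻ q (∈-resp-≡ dealt-slots s∈))

    Near : V → V → Set
    Near s v = Within 5 c v × Within 6 s v

    dealt-good : All Good dealt
    dealt-good = All.map (λ { {group c _ _} (len , near , refl) → len , near })
      (subst (λ ss → All (DealtTo Near) (deal q ss Z)) (sym (List.++-assoc front back (b ∷ [])))
        (deal-within q front (back ++ b ∷ []) R (free c ++ domain c) R≤front
          (λ s∈ v∈ → received s∈ v∈)
          λ s∈ v∈ → mine (origin-within (origin (∈-resp-≡ (sym (List.++-assoc front back (b ∷ []))) s∈))) (two v∈)))
      where
      two : ∀ {v} → v ∈ free c ++ domain c → Within 2 c v
      two v∈ with ∈-++⁻ (free c) v∈
      ... | inj₁ p = κ-within′ (free-κ p)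
      ... | inj₂ p = domain-within p
      mine : ∀ {s v} → Within 2 c s → Within 2 c v → Near s v
      mine cs cv = within-≤ (ℕ.m≤m+n 2 3) cv , within-≤ (ℕ.m≤m+n 4 2) (within-trans (within-sym cs) cv)
      received : ∀ {s v} → s ∈ front → v ∈ R → Near s v
      received s∈ v∈ with find (∈-concatMap⁻ (proj₂ ∘ store) {xs = nbrs} v∈)
      ... | a , a∈ , v∈a = cv , within-trans (within-sym (in-front s∈)) cv
        where cv = within-trans (adj⇒within (nbr⁻ a∈)) (proj₁ (proj₂ (pendingOk a)) _ v∈a)

    store′ : V → Pending
    store′ a = if does (adj? c a) then (a , []) else store a

    store′-elim : ∀ {p} (P : V → Pending → Set p) → (∀ a → P a (a , [])) → (∀ a → ¬ Adj c a → P a (store a)) →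
                  ∀ a → P a (store′ a)
    store′-elim P P[] Ps a with adj? c a
    ... | yes _ = P[] a
    ... | no ¬e = Ps a ¬e

    -- The parent recorded at `a` is not `c`, hence is yet to retire. The slot at `a` is not dealt:
    -- it lies outside the cluster of `c` and differs from every slot reserved at a neighbour of
    -- `c`.
    not-adjacent : ∀ {a} → ¬ Adj c a → Live (store a) → Reserved M (dealt ++ gs) a (proj₁ (store a))
    not-adjacent {a} ¬ca la = record
      { parent = case Reserved.parent r of λ
          { (p , here refl , e) → contradiction e ¬ca
          ; (p , there p∈ , e)  → p , p∈ , e }
      ; adj    = Reserved.adj r
      ; done   = Reserved.done r ∘ there
      ; fresh  = λ s∈ → case slot-++⁻ dealt s∈ of λ
          { (inj₂ old) → Reserved.fresh r old
          ; (inj₁ new) → clash (dealt-origin new) }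
      }
      where
      r = reserved la
      clash : ¬ Origin (proj₁ (store a))
      clash (own eq) = Reserved.done r (here eq)
      clash (passed a′ ca′ la′ eq) with distinct a a′ la la′ eq
      ... | refl = ¬ca ca′

    covered′ : ∀ v → home v ∈ M ⊎ (∃ λ a → v ∈ proj₂ (store′ a)) ⊎ v ∈ f ⊎ Served (dealt ++ gs) v
    covered′ v = case covered v of λ
      { (inj₁ (here refl))         → in-Z (∈-++⁺ʳ R ([ ∈-++⁺ˡ , ∈-++⁺ʳ (free (home v)) ]′ (home-∈ v)))
      ; (inj₁ (there h∈))          → inj₁ h∈
      ; (inj₂ (inj₁ (a , v∈)))     → from-store a v∈
      ; (inj₂ (inj₂ (inj₂ old)))   → inj₂ (inj₂ (inj₂ (Any.++⁺ʳ dealt old)))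
      }
      where
      Goal = home v ∈ M ⊎ (∃ λ a → v ∈ proj₂ (store′ a)) ⊎ v ∈ f ⊎ Served (dealt ++ gs) v
      in-Z : v ∈ Z → Goal
      in-Z v∈ with deal-covers Z q≤slots v∈
      ... | inj₁ new = inj₂ (inj₂ (inj₂ (Any.++⁺ˡ new)))
      ... | inj₂ v∈f = inj₂ (inj₂ (inj₁ v∈f))
      from-store : ∀ a → v ∈ proj₂ (store a) → Goal
      from-store a v∈ with adj? c a in eq
      ... | yes e = in-Z (∈-++⁺ˡ (∈-concatMap⁺ (proj₂ ∘ store) (lose (nbr⁺ e) v∈)))
      ... | no ¬e = inj₂ (inj₁ (a , subst (λ d → v ∈ proj₂ (if does d then (a , []) else store a)) (sym eq) v∈))

    pending-split : sumℕ (waiting ∘ store) ≡ length R + sumℕ (waiting ∘ store′)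
    pending-split = begin
      sumℕ (waiting ∘ store) ≡⟨ sum-cong-≗ pointwise ⟩
      sumℕ (λ a → taken a + waiting (store′ a)) ≡⟨ ∑-distrib-+ taken (waiting ∘ store′) ⟩
      sumℕ taken + sumℕ (waiting ∘ store′)
        ≡⟨ cong (_+ sumℕ (waiting ∘ store′)) (length-concatMap-filter (adj? c) (proj₂ ∘ store) id) ⟨
      length R + sumℕ (waiting ∘ store′) ∎
      where
      open ≡-Reasoning
      taken : V → ℕ
      taken a = if does (adj? c a) then waiting (store a) else 0
      pointwise : ∀ a → waiting (store a) ≡ taken a + waiting (store′ a)
      pointwise a with adj? c a
      ... | yes _ = sym (ℕ.+-identityʳ _)
      ... | no _  = refl

    length-dealt : length dealt ≡ q
    length-dealt = begin
      length dealt            ≡⟨ List.length-map slot dealt ⟨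
      length (map slot dealt) ≡⟨ cong length dealt-slots ⟩
      length (take q slots)   ≡⟨ List.length-take q slots ⟩
      q ℕ.⊓ length slots      ≡⟨ ℕ.m≤n⇒m⊓n≡m q≤slots ⟩
      q                       ∎
      where open ≡-Reasoning

    -- The `ℓ` set aside for `c` pays for its first centre; the other `w / ℓ` centres and the
    -- clients in `f` are charged to the received and free clients, which leave the account.
    budget′ : (length (dealt ++ gs) + length M) * ℓ +
              (sumℕ (waiting ∘ store′) + (length f + length (allFree M))) ≤ k * ℓ
    budget′ = begin
      (length (dealt ++ gs) + length M) * ℓ + (P′ + (length f + F))
        ≡⟨ cong (λ z → (z + length M) * ℓ + (P′ + (length f + F)))
             (trans (List.length-++ dealt) (cong (_+ length gs) length-dealt)) ⟩
      (suc (w / ℓ) + length gs + length M) * ℓ + (P′ + (length f + F))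
        ≡⟨ shuffle (w / ℓ) (length gs) (length M) ℓ P′ (length f) F ⟩
      (length gs + suc (length M)) * ℓ + (P′ + F) + ((w / ℓ) * ℓ + length f)
        ≤⟨ ℕ.+-monoʳ-≤ ((length gs + suc (length M)) * ℓ + (P′ + F)) f-spend ⟩
      (length gs + suc (length M)) * ℓ + (P′ + F) + w
        ≡⟨ shuffle′ ((length gs + suc (length M)) * ℓ) P′ F (length R) (length (free c)) ⟩
      (length gs + suc (length M)) * ℓ + (length R + P′ + (length (free c) + F))
        ≡⟨ cong₂ (λ p z → (length gs + suc (length M)) * ℓ + (p + z))
             (sym pending-split) (sym (List.length-++ (free c))) ⟩
      (length gs + suc (length M)) * ℓ + (sumℕ (waiting ∘ store) + length (allFree (c ∷ M)))
        ≤⟨ budget ⟩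
      k * ℓ ∎
      where
      open ℕ.≤-Reasoning
      P′ = sumℕ (waiting ∘ store′)
      F = length (allFree M)
      shuffle : ∀ t a m l p x y → (suc t + a + m) * l + (p + (x + y)) ≡ (a + suc m) * l + (p + y) + (t * l + x)
      shuffle = solve-∀
      shuffle′ : ∀ A p y r e → A + (p + y) + (r + e) ≡ A + (r + p + (e + y))
      shuffle′ = solve-∀

    state : State M f
    state = record
      { store     = store′
      ; gs        = dealt ++ gs
      ; pendingOk = store′-elim (PendingOk M (dealt ++ gs))
          (λ a → ℕ.≤-trans (s≤s z≤n) 2≤ℓ , (λ _ ()) , λ ())
          (λ a ¬ca → let short , near , _ = pendingOk a in short , near , not-adjacent ¬ca)
      ; distinct  = store′-elim (λ a x → ∀ a′ → Live x → Live (store′ a′) → proj₁ x ≡ proj₁ (store′ a′) → a ≡ a′)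
          (λ _ _ ()) (λ a _ → store′-elim (λ a′ x → Live (store a) → Live x → proj₁ (store a) ≡ proj₁ x → a ≡ a′)
            (λ _ _ ()) λ a′ _ → distinct a a′)
      ; good      = All.++⁺ dealt-good good
      ; unique    = subst Unique (sym (List.map-++ slot dealt gs))
          (Unique.++⁺ (subst Unique (sym dealt-slots) (Unique.take⁺ q slots-unique)) unique
            λ (p , p′) → origin-fresh (dealt-origin p) p′)
      ; done      = λ s∈ → case slot-++⁻ dealt s∈ of λ
          { (inj₁ new) → origin-done (dealt-origin new)
          ; (inj₂ old) → done old ∘ there }
      ; covered   = covered′
      ; budget    = budget′
      }

    f-within : ∀ {v} → v ∈ f → Within 2 c v
    f-within = domain-within ∘ f-domain

    -- Slots opened or reserved earlier lie outside the cluster of `c`, which contains `b`; `spare`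
    -- keeps `b` out of those dealt now.
    b-new : 1 ≤ length f → NewSlot state b
    b-new 1≤f = unused , store′-elim (λ _ x → Live x → proj₁ x ≢ b) (λ _ ())
        (λ a _ la eq → Reserved.done (reserved la) (here (trans (cong κ eq) (κ-adj cb))))
      where
      unused : b ∉ map slot (dealt ++ gs)
      unused b∈ = case slot-++⁻ dealt b∈ of λ
        { (inj₁ new) → b∉front-back (∈-take-++⁻ q (front ++ back) (spare 1≤f) (∈-resp-≡ dealt-slots new))
        ; (inj₂ old) → done old (here (κ-adj cb)) }

  -- Handing leftover clients to the parent

  module _ {M f} (S : State M f) {a b p} (p∈M : p ∈ M) (pa : Adj p a)
           (f-near : ∀ v → v ∈ f → Within 4 a v) (b-new : NewSlot S b) where
    open State S

    merged : List V
    merged = proj₂ (store a) ++ f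

    merged-near : ∀ v → v ∈ merged → Within 4 a v
    merged-near v v∈ = [ proj₁ (proj₂ (pendingOk a)) v , f-near v ]′ (∈-++⁻ (proj₂ (store a)) v∈)

    -- `b` becomes the slot reserved at `a`, replacing any earlier one. It is neither opened nor
    -- reserved elsewhere, so reserved slots stay distinct.
    deposit : Adj a b → κ b ∉ M → length merged < ℓ → State M []
    deposit ab b-done short = record
      { store     = updateAt store a (const (b , merged))
      ; gs        = gs
      ; pendingOk = updateAt-elim (PendingOk M gs) store a
          (short , merged-near , λ _ → record
            { parent = _ , p∈M , pa ; adj = ab ; done = b-done ; fresh = proj₁ b-new })
          λ j _ → pendingOk j
      ; distinct  = updateAt-elim
          (λ i x → ∀ j → Live x → Live (store′ j) → proj₁ x ≡ proj₁ (store′ j) → i ≡ j) store a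
          (updateAt-elim (λ j y → Live (b , merged) → Live y → b ≡ proj₁ y → a ≡ j) store a
            (λ _ _ _ → refl)
            λ j _ _ lj eq → contradiction (sym eq) (proj₂ b-new j lj))
          λ i _ → updateAt-elim (λ j y → Live (store i) → Live y → proj₁ (store i) ≡ proj₁ y → i ≡ j) store a
            (λ li _ eq → contradiction eq (proj₂ b-new i li))
            λ j _ → distinct i j
      ; good      = good
      ; unique    = unique
      ; done      = done
      ; covered   = λ v → case covered v of λ
          { (inj₁ h∈)                     → inj₁ h∈
          ; (inj₂ (inj₁ (j , v∈)))        → inj₂ (inj₁ (kept j v∈))
          ; (inj₂ (inj₂ (inj₁ v∈f)))      → inj₂ (inj₁ (a , at-a (∈-++⁺ʳ (proj₂ (store a)) v∈f)))
          ; (inj₂ (inj₂ (inj₂ sv)))       → inj₂ (inj₂ (inj₂ sv)) }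
      ; budget    = ℕ.≤-trans (ℕ.≤-reflexive (cong ((length gs + length M) * ℓ +_)
          (trans (cong (_+ length (allFree M)) sum′) (ℕ.+-assoc (sumℕ (waiting ∘ store)) (length f) _)))) budget
      }
      where
      store′ = updateAt store a (const (b , merged))
      at-a : ∀ {v} → v ∈ merged → v ∈ proj₂ (store′ a)
      at-a = ∈-resp-≡ (cong proj₂ (sym (updateAt-updates a store)))
      kept : ∀ j {v} → v ∈ proj₂ (store j) → ∃ λ j → v ∈ proj₂ (store′ j)
      kept j v∈ with j Fin.≟ a
      ... | yes refl = a , at-a (∈-++⁺ˡ v∈)
      ... | no j≢a   = j , ∈-resp-≡ (cong proj₂ (sym (updateAt-minimal j a store j≢a))) v∈
      sum′ : sumℕ (waiting ∘ store′) ≡ sumℕ (waiting ∘ store) + length f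
      sum′ = ℕ.+-cancelˡ-≡ (waiting (store a)) _ _ (begin
        waiting (store a) + sumℕ (waiting ∘ store′)  ≡⟨ sum-updateAt waiting store a (b , merged) ⟩
        length merged + sumℕ (waiting ∘ store)
          ≡⟨ cong (_+ sumℕ (waiting ∘ store)) (List.length-++ (proj₂ (store a))) ⟩
        waiting (store a) + length f + sumℕ (waiting ∘ store)
          ≡⟨ shuffle (waiting (store a)) (length f) (sumℕ (waiting ∘ store)) ⟩
        waiting (store a) + (sumℕ (waiting ∘ store) + length f) ∎)
        where
        open ≡-Reasoning
        shuffle : ∀ x y z → x + y + z ≡ x + (z + y)
        shuffle = solve-∀

    -- The new group uses the slot reserved earlier, so `b` stays available for the rest. The `ℓ`
    -- clients served pay for it exactly, which leaves the budget unchanged.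
    flush : Live (store a) → ℓ ≤ length merged →
            ∃ λ (S′ : State M (drop ℓ merged)) → NewSlot S′ b × proj₂ (State.store S′ a) ≡ []
    flush la full = record
      { store     = store′
      ; gs        = g ∷ gs
      ; pendingOk = updateAt-elim (PendingOk M (g ∷ gs)) store a
          (ℕ.≤-trans (s≤s z≤n) 2≤ℓ , (λ _ ()) , λ ())
          λ j j≢a → let short , near , res = pendingOk j in short , near , λ lj → record
            { parent = Reserved.parent (res lj)
            ; adj    = Reserved.adj (res lj)
            ; done   = Reserved.done (res lj)
            ; fresh  = λ { (here eq) → j≢a (distinct j a lj la eq)
                         ; (there s∈) → Reserved.fresh (res lj) s∈ } }
      ; distinct  = updateAt-elim
          (λ i x → ∀ j → Live x → Live (store′ j) → proj₁ x ≡ proj₁ (store′ j) → i ≡ j) store a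
          (λ _ ())
          λ i _ → updateAt-elim (λ j y → Live (store i) → Live y → proj₁ (store i) ≡ proj₁ y → i ≡ j) store a
            (λ _ ()) λ j _ → distinct i j
      ; good      = (subst (_≤ ℓ) (sym (List.length-take ℓ merged)) (ℕ.m⊓n≤m ℓ _) , g-near) ∷ good
      ; unique    = All.¬Any⇒All¬ _ (Reserved.fresh res-a) ∷ unique
      ; done      = λ { (here refl) → Reserved.done res-a ; (there s∈) → done s∈ }
      ; covered   = λ v → case covered v of λ
          { (inj₁ h∈)                     → inj₁ h∈
          ; (inj₂ (inj₁ (j , v∈)))        → kept j v∈
          ; (inj₂ (inj₂ (inj₁ v∈f)))      → split (∈-++⁺ʳ (proj₂ (store a)) v∈f)
          ; (inj₂ (inj₂ (inj₂ sv)))       → inj₂ (inj₂ (inj₂ (there sv))) }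
      ; budget    = ℕ.≤-trans (ℕ.≤-reflexive spent) budget
      } , ((λ { (here eq) → proj₂ b-new a la (sym eq) ; (there b∈) → proj₁ b-new b∈ })
          , updateAt-elim (λ _ x → Live x → proj₁ x ≢ b) store a (λ ()) (λ j _ → proj₂ b-new j))
        , cong proj₂ (updateAt-updates a store)
      where
      store′ = updateAt store a (const (a , []))
      g = group p (proj₁ (store a)) (take ℓ merged)
      res-a = proj₂ (proj₂ (pendingOk a)) la
      g-near : ∀ v → v ∈ take ℓ merged → Within 5 p v × Within 6 (proj₁ (store a)) v
      g-near v v∈ = within-trans (adj⇒within pa) av
                  , within-≤ (ℕ.n≤1+n 5) (within-trans (within-sym (adj⇒within (Reserved.adj res-a))) av)
        where av = merged-near v (∈-take⁻ ℓ v∈)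
      Goal : V → Set
      Goal v = home v ∈ M ⊎ (∃ λ j → v ∈ proj₂ (store′ j)) ⊎ v ∈ drop ℓ merged ⊎ Served (g ∷ gs) v
      split : ∀ {v} → v ∈ merged → Goal v
      split v∈ with ∈-take-or-drop ℓ v∈
      ... | inj₁ t = inj₂ (inj₂ (inj₂ (here t)))
      ... | inj₂ d = inj₂ (inj₂ (inj₁ d))
      kept : ∀ j {v} → v ∈ proj₂ (store j) → Goal v
      kept j v∈ with j Fin.≟ a
      ... | yes refl = split (∈-++⁺ˡ v∈)
      ... | no j≢a   = inj₂ (inj₁ (j , ∈-resp-≡ (cong proj₂ (sym (updateAt-minimal j a store j≢a))) v∈))
      spent : (suc (length gs) + length M) * ℓ +
                (sumℕ (waiting ∘ store′) + (length (drop ℓ merged) + length (allFree M)))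
            ≡ (length gs + length M) * ℓ + (sumℕ (waiting ∘ store) + (length f + length (allFree M)))
      spent = begin
        (suc (length gs) + length M) * ℓ + (P′ + (length (drop ℓ merged) + F))
          ≡⟨ shuffle (length gs + length M) ℓ P′ (length (drop ℓ merged)) F ⟩
        (length gs + length M) * ℓ + (P′ + ((ℓ + length (drop ℓ merged)) + F))
          ≡⟨ cong (λ z → (length gs + length M) * ℓ + (P′ + (z + F)))
               (trans (cong (ℓ +_) (List.length-drop ℓ merged)) (trans (ℕ.m+[n∸m]≡n full) (List.length-++ (proj₂ (store a))))) ⟩
        (length gs + length M) * ℓ + (P′ + ((waiting (store a) + length f) + F))
          ≡⟨ shuffle′ ((length gs + length M) * ℓ) P′ (waiting (store a)) (length f) F ⟩
        (length gs + length M) * ℓ + ((waiting (store a) + P′) + (length f + F))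
          ≡⟨ cong (λ z → (length gs + length M) * ℓ + (z + (length f + F))) (sum-updateAt waiting store a (a , [])) ⟩
        (length gs + length M) * ℓ + (sumℕ (waiting ∘ store) + (length f + F)) ∎
        where
        open ≡-Reasoning
        P′ = sumℕ (waiting ∘ store′)
        F = length (allFree M)
        shuffle : ∀ m l p d x → suc m * l + (p + (d + x)) ≡ m * l + (p + (l + d + x))
        shuffle = solve-∀
        shuffle′ : ∀ A p y z x → A + (p + (y + z + x)) ≡ A + (y + p + (z + x))
        shuffle′ = solve-∀

  settle : ∀ {M f} (S : State M f) {a b p} → p ∈ M → Adj a p → Adj a b → κ b ∉ M → length f < ℓ →
           (∀ v → v ∈ f → Within 4 a v) → (1 ≤ length f → NewSlot S b) → State M []
  settle {f = []}    S p∈ ap ab b-done f<ℓ near new = S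
  settle {f = v ∷ f} S {a} p∈ ap ab b-done f<ℓ near new with length (merged S p∈ (adj-sym ap) near (new (s≤s z≤n))) ℕ.<? ℓ
  ... | yes short = deposit S p∈ (adj-sym ap) near (new (s≤s z≤n)) ab b-done short
  ... | no ¬short with flush S p∈ (adj-sym ap) near (new (s≤s z≤n)) la (ℕ.≮⇒≥ ¬short)
    where
    -- `f` alone is shorter than `ℓ`, so someone was already waiting at `a` and a slot is reserved
    -- there.
    la : Live (State.store S a)
    la with proj₂ (State.store S a)
    ... | []    = contradiction f<ℓ ¬short
    ... | _ ∷ _ = s≤s z≤n
  ...   | S′ , new′ , empty = deposit S′ p∈ (adj-sym ap)
          (λ u u∈ → merged-near S p∈ (adj-sym ap) near (new (s≤s z≤n)) u (∈-drop⁻ ℓ u∈)) new′ ab b-done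
          -- Fewer than `ℓ` were waiting and fewer than `ℓ` arrived, so fewer than `ℓ` remain once
          -- `ℓ` are served.
          (subst (λ ws → length (ws ++ drop ℓ ms) < ℓ) (sym empty)
            (subst (_< ℓ) (sym (List.length-drop ℓ ms)) (ℕ.≤-<-trans (ℕ.m≤n+o⇒m∸n≤o _ ℓ
              (ℕ.≤-trans (ℕ.≤-reflexive (List.length-++ (proj₂ (State.store S a))))
                (ℕ.+-monoˡ-≤ _ (ℕ.<⇒≤ (proj₁ (State.pendingOk S a)))))) f<ℓ)))
    where ms = merged S p∈ (adj-sym ap) near (new (s≤s z≤n))

  -- The root has no parent to take its leftover, so one more centre opens. A nonempty `f` makes
  -- `length gs * ℓ` strictly less than `k * ℓ`, which leaves room for it.
  finish : ∀ {f c b} (S : State [] f) → Adj c b → length f < ℓ → (∀ v → v ∈ f → Within 2 c v) →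
           (1 ≤ length f → NewSlot S b) → Result
  finish {f} {c} {b} S cb f<ℓ near new = close f refl
    where
    open State S
    covered′ : ∀ v → v ∈ f ⊎ Served gs v
    covered′ v with covered v
    ... | inj₂ (inj₂ done) = done
    -- A waiting client would need a parent among the monarchs yet to retire, and there are none.
    ... | inj₂ (inj₁ (a , v∈)) with Reserved.parent (proj₂ (proj₂ (pendingOk a)) (∈-length v∈))
    ...   | _ , () , _
    spent : length gs * ℓ + length f ≤ k * ℓ
    spent = ℕ.≤-trans (ℕ.+-mono-≤ (ℕ.*-monoˡ-≤ ℓ (ℕ.m≤m+n (length gs) 0))
      (ℕ.≤-trans (ℕ.m≤m+n (length f) 0) (ℕ.m≤n+m _ (sumℕ (waiting ∘ store))))) budget
    close : ∀ f′ → f ≡ f′ → Result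
    close [] refl = record
      { gs = gs ; good = good ; unique = unique
      ; size = ℕ.*-cancelʳ-≤ _ _ ℓ (ℕ.≤-trans (ℕ.m≤m+n _ 0) spent)
      ; served = λ v → case covered′ v of λ { (inj₂ s) → s }
      }
    close (u ∷ us) refl = record
      { gs = group c b f ∷ gs
      ; good = (ℕ.<⇒≤ f<ℓ , λ v v∈ → within-≤ (ℕ.m≤m+n 2 3) (near v v∈)
                , within-≤ (ℕ.m≤m+n 3 3) (within-trans (within-sym (adj⇒within cb)) (near v v∈))) ∷ good
      ; unique = All.¬Any⇒All¬ _ (proj₁ (new (s≤s z≤n))) ∷ unique
      ; size = ℕ.*-cancelʳ-< ℓ _ _ (ℕ.<-≤-trans (ℕ.m<m+n (length gs * ℓ) (s≤s z≤n)) spent)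
      ; served = λ v → [ here , there ]′ (covered′ v)
      }

  run : ∀ {M} → Tree M → (∀ {m} → m ∈ M → m ∈ M₀) → State M [] → Result
  run (root rb) sub S = finish state rb f<ℓ (λ _ → f-within) b-new
    where open Retire (sub (here refl)) (λ ()) rb S
  run T′@(grow {c = c} {b} {a} {p} T cb ba ap p∈ far) sub S =
    run T (sub ∘ there) (settle state p∈ ap (adj-sym ba) b-done f<ℓ
      (λ _ v∈ → within-trans (within-trans (adj⇒within (adj-sym ba)) (adj⇒within (adj-sym cb))) (f-within v∈))
      b-new)
    where
    c∉ = Unique.Unique[x∷xs]⇒x∉xs (tree-unique T′)
    open Retire (sub (here refl)) c∉ cb S
    b-done : κ b ∉ _
    b-done b∈ = c∉ (subst (_∈ _) (κ-adj cb) b∈)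

  rounding : Tree M₀ → Result
  rounding T = run T id initial

-- From groups to solutions

_∈?_ : ∀ {n} (v : Fin n) xs → Dec (v ∈ xs)
v ∈? xs = Any.any? (v Fin.≟_) xs

∣tabulate∣ : ∀ {n} (χ : Fin n → Bool) → ∣ Vec.tabulate χ ∣ ≡ count χ
∣tabulate∣ {zero}  χ = refl
∣tabulate∣ {suc n} χ with χ zero
... | true  = cong suc (∣tabulate∣ (χ ∘ suc))
... | false = ∣tabulate∣ (χ ∘ suc)

count-lookup : ∀ {n} (A : Subset n) → count (Vec.lookup A) ≡ ∣ A ∣
count-lookup []            = refl
count-lookup (outside ∷ A) = count-lookup A
count-lookup (inside  ∷ A) = cong suc (count-lookup A)

count-true : ∀ n → count {n} (const true) ≡ n
count-true zero    = refl
count-true (suc n) = cong suc (count-true n)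

does⁻ : ∀ {p} {P : Set p} (P? : Dec P) → does P? ≡ true → P
does⁻ (yes p) _ = p

∣tabulate∣≤length : ∀ {n p} {P : Fin n → Set p} (P? : Decidable P) {xs} →
  (∀ {v} → P v → v ∈ xs) → ∣ Vec.tabulate (λ v → does (P? v)) ∣ ≤ length xs
∣tabulate∣≤length {n} P? {xs} P⊆xs = begin
  ∣ Vec.tabulate (λ v → does (P? v)) ∣ ≡⟨ ∣tabulate∣ (λ v → does (P? v)) ⟩
  count (λ v → does (P? v))            ≡⟨ length-filter-tabulate P? id ⟨
  length (filter P? (allFin n))        ≤⟨ unique-⊆⇒length≤ (Unique.filter⁺ P? (Unique.allFin⁺ n))
                                            (λ v∈ → P⊆xs (proj₂ (∈-filter⁻ P? {xs = allFin n} v∈))) ⟩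
  length xs                            ∎
  where open ℕ.≤-Reasoning

unique-map-injective : ∀ {a b} {A : Set a} {B : Set b} {f : A → B} {xs} → Unique (map f xs) →
  ∀ {x y} → x ∈ xs → y ∈ xs → f x ≡ f y → x ≡ y
unique-map-injective _        (here refl) (here refl) _  = refl
unique-map-injective {f = f} (x∉ ∷ _) (here refl) (there q) eq = contradiction eq (All.lookup x∉ (∈-map⁺ f q))
unique-map-injective {f = f} (x∉ ∷ _) (there p) (here refl) eq = contradiction (sym eq) (All.lookup x∉ (∈-map⁺ f p))
unique-map-injective (_ ∷ u) (there p) (there q) eq = unique-map-injective u p q eq

length-concatMap-All≤ : ∀ {a b} {A : Set a} {B : Set b} (h : A → List B) {ℓ xs} →
  All (λ x → length (h x) ≤ ℓ) xs → length (concatMap h xs) ≤ ℓ * length xs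
length-concatMap-All≤ h {ℓ} []                   = z≤n
length-concatMap-All≤ h {ℓ} {x ∷ xs} (hx ∷ hxs) = begin
  length (h x ++ concatMap h xs)        ≡⟨ List.length-++ (h x) ⟩
  length (h x) + length (concatMap h xs) ≤⟨ ℕ.+-mono-≤ hx (length-concatMap-All≤ h hxs) ⟩
  ℓ + ℓ * length xs                     ≡⟨ ℕ.*-suc ℓ (length xs) ⟨
  ℓ * suc (length xs)                   ∎
  where open ℕ.≤-Reasoning

sum-fibres : ∀ {a} {A : Set a} {n} (f : A → Fin n) xs →
             sumℕ (λ u → length (filter (λ x → f x Fin.≟ u) xs)) ≡ length xs
sum-fibres {n = n} f []       = sum-zeroℕ {n} λ _ → refl
sum-fibres f (x ∷ xs) = begin
  sumℕ (λ u → length (filter (λ x → f x Fin.≟ u) (x ∷ xs)))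
    ≡⟨ sum-cong-≗ split ⟩
  sumℕ (λ u → [ does (f x Fin.≟ u) ] + length (filter (λ x → f x Fin.≟ u) xs))
    ≡⟨ ∑-distrib-+ (λ u → [ does (f x Fin.≟ u) ]) _ ⟩
  count (λ u → does (f x Fin.≟ u)) + sumℕ (λ u → length (filter (λ x → f x Fin.≟ u) xs))
    ≡⟨ cong₂ _+_ (count-≟ (f x)) (sum-fibres f xs) ⟩
  suc (length xs) ∎
  where
  open ≡-Reasoning
  split : ∀ u → length (filter (λ x → f x Fin.≟ u) (x ∷ xs)) ≡
                [ does (f x Fin.≟ u) ] + length (filter (λ x → f x Fin.≟ u) xs)
  split u with f x Fin.≟ u
  ... | yes _ = refl
  ... | no _  = refl

Solutions : ∀ {n} (G : Graph n) → Connected G → (Fin n → ℕ) → ℕ → Set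
Solutions G conn L k = HardSolution (power G conn 6) L k × SoftSolution (power G conn 5) L k

module _ {n} (G : Graph n) (conn : Connected G) (L : Fin n → ℕ) (k : ℕ) where
  open Distance G conn

  self-service : n ≤ k → (∀ u → 1 ≤ L u) → Solutions G conn L k
  self-service n≤k 1≤L = record
    { S = Subset.⊤ ; ∣S∣≤k = subst (_≤ k) (sym (∣⊤∣≡n n)) n≤k ; φ = id ; φ∈S = λ _ → ∈⊤
    ; near = λ _ → inj₁ refl ; capacity = λ u _ → ℕ.≤-trans (fibre≤1 u) (1≤L u) }
    , record
    { m = const 1 ; Σm≤k = subst (_≤ k) (sym (count-true n)) n≤k ; φ = id ; open-φ = λ _ → s≤s z≤n
    ; near = λ _ → inj₁ refl
    ; capacity = λ u → ℕ.≤-trans (fibre≤1 u) (subst (1 ≤_) (sym (ℕ.*-identityʳ (L u))) (1≤L u)) }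
    where
    fibre≤1 : ∀ u → ∣ fibre id u ∣ ≤ 1
    fibre≤1 u = ∣tabulate∣≤length (λ v → v Fin.≟ u) {u ∷ []} λ eq → here eq

  within⇒near : ∀ {d u v} → Within d u v → u ≡ v ⊎ Graph.Adj (power G conn d) u v
  within⇒near {u = u} {v} w with u Fin.≟ v
  ... | yes eq = inj₁ eq
  ... | no u≢v = inj₂ (u≢v , w)

module FromGroups {n} (G : Graph n) (conn : Connected G) (L : Fin n → ℕ) (k ℓ : ℕ) (L≡ℓ : ∀ u → L u ≡ ℓ)
  {gs : List (Group {n})} (size : length gs ≤ k) (unique : Unique (map Group.slot gs))
  (good : All (λ g → length (Group.clients g) ≤ ℓ × (∀ v → v ∈ Group.clients g →
                     Distance.Within G conn 5 (Group.centre g) v × Distance.Within G conn 6 (Group.slot g) v)) gs)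
  (served : ∀ v → Any (λ g → v ∈ Group.clients g) gs) where
  open Group

  server : Fin n → Group
  server v = proj₁ (find (served v))

  server∈ : ∀ v → server v ∈ gs
  server∈ v = proj₁ (proj₂ (find (served v)))

  server-serves : ∀ v → v ∈ clients (server v)
  server-serves v = proj₂ (proj₂ (find (served v)))

  used? : Decidable (_∈ map slot gs)
  used? u = u ∈? map slot gs

  ∈-used⁺ : ∀ {u} → u ∈ map slot gs → u Subset.∈ Vec.tabulate (λ u → does (used? u))
  ∈-used⁺ {u} u∈ = lookup⇒[]= u _ (trans (lookup∘tabulate _ u) (dec-true (used? u) u∈))

  ∈-used⁻ : ∀ {u} → u Subset.∈ Vec.tabulate (λ u → does (used? u)) → u ∈ map slot gs
  ∈-used⁻ {u} u∈ = does⁻ (used? u) (trans (sym (lookup∘tabulate _ u)) ([]=⇒lookup u∈))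

  hard : HardSolution (power G conn 6) L k
  hard = record
    { S = Vec.tabulate (λ u → does (used? u))
    ; ∣S∣≤k = ℕ.≤-trans (∣tabulate∣≤length used? id) (ℕ.≤-trans (ℕ.≤-reflexive (List.length-map slot gs)) size)
    ; φ = slot ∘ server
    ; φ∈S = λ v → ∈-used⁺ (∈-map⁺ slot (server∈ v))
    ; near = λ v → within⇒near G conn L k (proj₂ (proj₂ (All.lookup good (server∈ v)) v (server-serves v)))
    ; capacity = λ u u∈ → subst (∣ fibre (slot ∘ server) u ∣ ≤_) (sym (L≡ℓ u)) (cap u (∈-map⁻ slot (∈-used⁻ u∈)))
    }
    where
    -- Slots are distinct, so all clients sent to `u` belong to one group.
    cap : ∀ u → (∃ λ g → g ∈ gs × u ≡ slot g) → ∣ fibre (slot ∘ server) u ∣ ≤ ℓ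
    cap u (g , g∈ , u≡) = ℕ.≤-trans
      (∣tabulate∣≤length (λ v → slot (server v) Fin.≟ u) λ {v} eq →
        subst (λ h → v ∈ clients h) (unique-map-injective unique (server∈ v) g∈ (trans eq u≡)) (server-serves v))
      (proj₁ (All.lookup good g∈))

  -- Several groups may share a centre; the multiplicity of `u` is the number of groups centred
  -- there.
  soft : SoftSolution (power G conn 5) L k
  soft = record
    { m = λ u → length (at u)
    ; Σm≤k = subst (_≤ k) (sym (sum-fibres centre gs)) size
    ; φ = centre ∘ server
    ; open-φ = λ v → ∈-length (server∈at v refl)
    ; near = λ v → within⇒near G conn L k (proj₁ (proj₂ (All.lookup good (server∈ v)) v (server-serves v)))
    ; capacity = λ u → subst (λ l → ∣ fibre (centre ∘ server) u ∣ ≤ l * length (at u)) (sym (L≡ℓ u)) (ℕ.≤-trans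
        (∣tabulate∣≤length (λ v → centre (server v) Fin.≟ u) {concatMap clients (at u)} λ {v} eq →
          ∈-concatMap⁺ clients (lose (server∈at v eq) (server-serves v)))
        (length-concatMap-All≤ clients (All.filter⁺ _ (All.map proj₁ good))))
    }
    where
    at : Fin n → List Group
    at u = filter (λ g → centre g Fin.≟ u) gs
    server∈at : ∀ v {u} → centre (server v) ≡ u → server v ∈ at u
    server∈at v eq = ∈-filter⁺ (λ g → centre g Fin.≟ _) (server∈ v) eq

-- Hall's condition for lodging the clients

module _ {p : ℕ} where

  hit⁺ : ∀ {n} (N : Fin n → Fin p → Bool) A {v j} → Vec.lookup A v ≡ true → N v j ≡ true → hit N A j ≡ true
  hit⁺ N (b ∷ A) {zero}  refl eq rewrite eq = refl
  hit⁺ N (b ∷ A) {suc v} v∈   eq rewrite hit⁺ (N ∘ suc) A {v} v∈ eq = Bool.∨-zeroʳ _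

  unhit⇒empty : ∀ {n} (N : Fin n → Fin p → Bool) A {j} → (∀ v → N v j ≡ true) → hit N A j ≡ false → ∣ A ∣ ≡ 0
  unhit⇒empty N []            all _ = refl
  unhit⇒empty N (outside ∷ A) all h = unhit⇒empty (N ∘ suc) A (all ∘ suc) h
  unhit⇒empty N (inside  ∷ A) all h rewrite all zero = case h of λ ()

module _ {n} (G : Graph n) (conn : Connected G) (k ℓ : ℕ) .{{_ : NonZero ℓ}} where
  open Monarchs G conn
  open Distance G conn

  module Lodging {M} (M-unique : Unique M)
    (lp : (χ ψ : Fin n → Bool) →
      (∀ {m m′} → ψ m ≡ true → ψ m′ ≡ true → m ≢ m′ → ¬ Within 2 m m′) →
      (∀ {v m} → χ v ≡ true → ψ m ≡ true → ¬ Within 2 m v) →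
      count χ + ℓ * count ψ ≤ ℓ * k)
    (packed : ∀ {m m′} → m ∈ M → m′ ∈ M → m ≢ m′ → ¬ Within 2 m m′) where

    lodges? : ∀ v → Decidable (λ m → m ∈ M × Within 2 m v)
    lodges? v m = m ∈? M ×-dec dist G conn m v ℕ.≤? 2

    N : Fin n → Fin (suc n) → Bool
    N v zero    = true
    N v (suc m) = does (lodges? v m)

    -- Position `zero` is the pool of free clients, open to everyone: it holds what `k` centres can
    -- serve beyond one full centre per monarch.
    room : Fin (suc n) → ℕ
    room zero    = (k ∸ length M) * ℓ
    room (suc _) = ℓ

    M≤count : length M ≤ count (λ m → does (m ∈? M))
    M≤count = subst (length M ≤_) (length-filter-tabulate (_∈? M) id)
      (unique-⊆⇒length≤ M-unique λ {v} v∈ → ∈-filter⁺ (_∈? M) (∈-allFin v) v∈)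

    closed : Subset n → Fin n → Bool
    closed A m = does (m ∈? M) ∧ not (hit N A (suc m))

    closed⁻ : ∀ A {m} → closed A m ≡ true → m ∈ M × hit N A (suc m) ≡ false
    closed⁻ A {m} h with m ∈? M | hit N A (suc m)
    ... | yes m∈ | false = m∈ , refl

    hits : Subset n → ℕ
    hits A = count (λ m → hit N A (suc m))

    M≤closed+hits : ∀ A → length M ≤ count (closed A) + hits A
    M≤closed+hits A = begin
      length M                                        ≤⟨ M≤count ⟩
      count (λ m → does (m ∈? M))                     ≤⟨ sum-mono-≤ pointwise ⟩
      sumℕ (λ m → [ closed A m ] + [ hit N A (suc m) ]) ≡⟨ ∑-distrib-+ (λ m → [ closed A m ]) _ ⟩
      count (closed A) + hits A                       ∎
      where
      open ℕ.≤-Reasoning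
      pointwise : ∀ m → [ does (m ∈? M) ] ≤ [ closed A m ] + [ hit N A (suc m) ]
      pointwise m with does (m ∈? M) | hit N A (suc m)
      ... | false | _     = z≤n
      ... | true  | false = ℕ.≤-refl
      ... | true  | true  = ℕ.≤-refl

    -- The LP inequality with `A` as the clients and the monarchs beyond its reach as ψ. The
    -- remaining monarchs are hit by `A` and appear on the right, in place of a subtraction on the
    -- left.
    bound : ∀ A → ∣ A ∣ + ℓ * length M ≤ ℓ * k + ℓ * hits A
    bound A = begin
      ∣ A ∣ + ℓ * length M                          ≤⟨ ℕ.+-monoʳ-≤ ∣ A ∣ (ℕ.*-monoʳ-≤ ℓ (M≤closed+hits A)) ⟩
      ∣ A ∣ + ℓ * (count (closed A) + hits A)       ≡⟨ cong (∣ A ∣ +_) (ℕ.*-distribˡ-+ ℓ (count (closed A)) (hits A)) ⟩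
      ∣ A ∣ + (ℓ * count (closed A) + ℓ * hits A)   ≡⟨ ℕ.+-assoc ∣ A ∣ _ _ ⟨
      ∣ A ∣ + ℓ * count (closed A) + ℓ * hits A     ≡⟨ cong (λ z → z + ℓ * count (closed A) + ℓ * hits A) (count-lookup A) ⟨
      count (Vec.lookup A) + ℓ * count (closed A) + ℓ * hits A
        ≤⟨ ℕ.+-monoˡ-≤ (ℓ * hits A) (lp (Vec.lookup A) (closed A)
             (λ h h′ → packed (proj₁ (closed⁻ A h)) (proj₁ (closed⁻ A h′)))
             (λ {v} {m} v∈ h w → let m∈ , unhit = closed⁻ A h in
               case trans (sym unhit) (hit⁺ N A v∈ (dec-true (lodges? v m) (m∈ , w))) of λ ())) ⟩
      ℓ * k + ℓ * hits A                            ∎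
      where open ℕ.≤-Reasoning

    -- With no clients at all, no monarch is hit and `bound` speaks of all of `M`.
    M≤k : length M ≤ k
    M≤k = ℕ.*-cancelˡ-≤ ℓ (begin
      ℓ * length M                 ≤⟨ ℕ.m≤n+m _ ∣ Subset.⊥ {n} ∣ ⟩
      ∣ Subset.⊥ {n} ∣ + ℓ * length M ≤⟨ bound Subset.⊥ ⟩
      ℓ * k + ℓ * hits Subset.⊥    ≡⟨ cong (λ z → ℓ * k + ℓ * z) (sum-zeroℕ {n} λ m → cong [_] (hit-⊥ N (suc m))) ⟩
      ℓ * k + ℓ * 0                ≡⟨ cong (ℓ * k +_) (ℕ.*-zeroʳ ℓ) ⟩
      ℓ * k + 0                    ≡⟨ ℕ.+-identityʳ _ ⟩
      ℓ * k                        ∎)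
      where open ℕ.≤-Reasoning

    -- A set that misses the pool is empty. Any other has the whole pool and `ℓ` for each monarch it
    -- hits, which is what `bound` asks for.
    hall-condition : Hall N room
    hall-condition A with hit N A zero in eq
    ... | false = ℕ.≤-trans (ℕ.≤-reflexive (unhit⇒empty N A (λ _ → refl) eq)) z≤n
    ... | true  = ℕ.+-cancelʳ-≤ (ℓ * length M) _ _ (begin
      ∣ A ∣ + ℓ * length M                                   ≤⟨ bound A ⟩
      ℓ * k + ℓ * hits A                                     ≡⟨ cong (λ z → ℓ * z + ℓ * hits A) (ℕ.m∸n+n≡m M≤k) ⟨
      ℓ * (k ∸ length M + length M) + ℓ * hits A             ≡⟨ shuffle ℓ (k ∸ length M) (length M) (hits A) ⟩
      (k ∸ length M) * ℓ + hits A * ℓ + ℓ * length M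
        ≡⟨ cong (λ z → (k ∸ length M) * ℓ + z + ℓ * length M)
             (trans (*-distribʳ-sum ℓ (λ m → [ hit N A (suc m) ])) (sum-cong-≗ λ m → scale (hit N A (suc m)))) ⟩
      (k ∸ length M) * ℓ + sumℕ (λ m → if hit N A (suc m) then ℓ else 0) + ℓ * length M ∎)
      where
      open ℕ.≤-Reasoning
      shuffle : ∀ l x y h → l * (x + y) + l * h ≡ x * l + h * l + l * y
      shuffle = solve-∀
      scale : ∀ b → [ b ] * ℓ ≡ (if b then ℓ else 0)
      scale true  = ℕ.+-identityʳ ℓ
      scale false = refl

    lodging = hall N room hall-condition

    α : Fin n → Fin (suc n)
    α = proj₁ lodging

    α-near : ∀ {v m} → α v ≡ suc m → m ∈ M × Within 2 m v
    α-near {v} {m} eq = does⁻ (lodges? v m) (subst (λ j → N v j ≡ true) eq (proj₁ (proj₂ lodging) v))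

    α-room : ∀ j → length (filter (λ v → α v Fin.≟ j) (allFin n)) ≤ room j
    α-room j = subst (_≤ room j) (sym (length-filter-tabulate (λ v → α v Fin.≟ j) id)) (proj₂ (proj₂ lodging) j)

    α-free : length M * ℓ + length (filter (λ v → α v Fin.≟ zero) (allFin n)) ≤ k * ℓ
    α-free = begin
      length M * ℓ + length (filter (λ v → α v Fin.≟ zero) (allFin n)) ≤⟨ ℕ.+-monoʳ-≤ (length M * ℓ) (α-room zero) ⟩
      length M * ℓ + (k ∸ length M) * ℓ ≡⟨ ℕ.*-distribʳ-+ ℓ (length M) (k ∸ length M) ⟨
      (length M + (k ∸ length M)) * ℓ   ≡⟨ cong (_* ℓ) (ℕ.m+[n∸m]≡n M≤k) ⟩
      k * ℓ                             ∎
      where open ℕ.≤-Reasoning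

-- Small cases and assembly

soft-feasible⇒solutions : ∀ {c ℓ₁ ℓ₂} (F : OrderedField c ℓ₁ ℓ₂) {n} (G : Graph n) (conn : Connected G)
  (L : Fin n → ℕ) → (∀ u v → L u ≡ L v) → (k : ℕ) .{{_ : NonZero k}} →
  SoftLP1Feasible F G conn L k → Solutions G conn L k
soft-feasible⇒solutions F {zero} G conn L uniform k feasible =
  self-service G conn L k z≤n λ ()
soft-feasible⇒solutions F {suc n} G conn L uniform k feasible = by-capacity (L zero) λ u → uniform u zero
  where
  -- The LP inequality with every vertex a client and ψ empty. It excludes capacity 0 and, for
  -- capacity 1, lets every vertex serve itself.
  n≤ℓk : ∀ ℓ → (∀ u → L u ≡ ℓ) → suc n ≤ ℓ * k
  n≤ℓk ℓ L≡ℓ = begin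
    suc n                                             ≡⟨ count-true (suc n) ⟨
    count {suc n} (const true)                        ≤⟨ ℕ.m≤m+n _ _ ⟩
    count {suc n} (const true) + ℓ * count {suc n} (const false)
      ≤⟨ LPBound.clients+closed≤ F G conn L k ℓ L≡ℓ feasible (const true) (const false) (λ ()) (λ _ ()) ⟩
    ℓ * k                                             ∎
    where open ℕ.≤-Reasoning

  edge : ∀ {m} {G : Graph (suc (suc m))} → Connected G → ∃ λ b → Graph.Adj G zero b
  edge conn with conn zero (suc zero)
  ... | _ , e ∷ _ = _ , e

  large : ∀ {m} (G : Graph (suc (suc m))) (conn : Connected G) (L : Fin (suc (suc m)) → ℕ) ℓ .{{_ : NonZero ℓ}} →
          2 ≤ ℓ → (∀ u → L u ≡ ℓ) → SoftLP1Feasible F G conn L k → Solutions G conn L k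
  large G conn L ℓ 2≤ℓ L≡ℓ feasible with Monarchs.spanning-tree G conn (proj₂ (edge conn))
  ... | M , T , cov = FG.hard , FG.soft
    where
    open Monarchs G conn
    open Lodging G conn k ℓ (tree-unique T) (LPBound.clients+closed≤ F G conn L k ℓ L≡ℓ feasible) (tree-packed T)
    open Rounding G conn (clustering T cov) ℓ 2≤ℓ k α α-near (α-room ∘ suc) α-free (tree-unique T)
    module Res = Result (rounding T)
    module FG = FromGroups G conn L k ℓ L≡ℓ Res.size Res.unique Res.good Res.served

  by-capacity : ∀ ℓ → (∀ u → L u ≡ ℓ) → Solutions G conn L k
  by-capacity zero L≡0 = case n≤ℓk 0 L≡0 of λ ()
  by-capacity (suc zero) L≡1 = self-service G conn L k
    (subst (suc n ≤_) (ℕ.*-identityˡ k) (n≤ℓk 1 L≡1)) λ u → ℕ.≤-reflexive (sym (L≡1 u))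
  by-capacity ℓ@(suc (suc _)) L≡ℓ = by-order n G conn L L≡ℓ feasible
    where
    by-order : ∀ n (G : Graph (suc n)) (conn : Connected G) (L : Fin (suc n) → ℕ) → (∀ u → L u ≡ ℓ) →
               SoftLP1Feasible F G conn L k → Solutions G conn L k
    -- A single vertex has no neighbour to start a tree with, but it can serve itself because `k` is
    -- positive.
    by-order zero G conn L L≡ℓ _ = self-service G conn L k (ℕ.>-nonZero⁻¹ k) λ u → subst (1 ≤_) (sym (L≡ℓ u)) (s≤s z≤n)
    by-order (suc m) G conn L L≡ℓ feasible = large G conn L ℓ (s≤s (s≤s z≤n)) L≡ℓ feasible

theorem7 :
    ∀ {c ℓ₁ ℓ₂ : Level} (F : OrderedField c ℓ₁ ℓ₂)
      {n : ℕ} (G : Graph n) (conn : Connected G)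
      (L : Fin n → ℕ) → (∀ u v → L u ≡ L v) →
      (k : ℕ) .{{_ : NonZero k}} →
      (LP1Feasible F G conn L k → HardSolution (power G conn 6) L k)
      × (SoftLP1Feasible F G conn L k → SoftSolution (power G conn 5) L k)
theorem7 F G conn L uniform k =
  (λ (x , y , solution) → proj₁ (solutions (x , y , IsLP1Solution.isSoftLP1Solution solution))) ,
  (λ feasible → proj₂ (solutions feasible))
  where solutions = soft-feasible⇒solutions F G conn L uniform k
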